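{- Let $\mathbf A$ be a finite symmetric relation algebra with a normal representation such that $\mathbf A$ has all $1$-cycles and admits a Siggers behavior; let $\mathfrak A_0$ be its atom structure and $\mathfrak A_0^b$ its binarisation, and assume that $\mathrm{Pol}(\mathfrak A_0^b)$ contains a Siggers operation and $\mathfrak A_0^b$ has no affine edge. Let $v,w\in\mathrm{Pol}(\mathfrak A_0^b)$ be binary resp. ternary operations such that for every two-element $C\subseteq A_0$: $v|_C$ is a semilattice operation if $C$ has a semilattice edge in $\mathfrak A_0^b$ and $v|_C(x,y)=x$ otherwise; $w|_C$ is a majority operation if $C$ is a majority edge of $\mathfrak A_0^b$ and $w|_C(x,y,z)=v|_C(v|_C(x,y),z)$ if $C$ has a semilattice edge. Let $u(x,y,z):=w(v(v(x,y),z),v(v(y,z),x),v(v(z,x),y))$. If $u\in\mathrm{Pol}(\mathfrak A_0^b)$, then $u\in\mathrm{Pol}(\mathfrak A_0)$.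
   Context: $\mathbf A=(A;\cup,\bar{\ },0,1,\mathrm{id},\breve{\ },\circ)$ is a relation algebra (Tarski's axioms), symmetric if $\breve a=a$; $A_0$ is its set of atoms; $R=\{(x,y,z)\in A_0^3\mid z\le x\circ y\}$ is the set of allowed triples. $\mathbf A$ has all $1$-cycles if $(a,a,a)\in R$ for all $a$; it admits a Siggers behavior if there is $s\colon A_0^6\to A_0$ preserving $R$, with $s(x_1,\dots,x_6)\in\{x_1,\dots,x_6\}$ and $s(x,x,y,y,z,z)=s(y,z,x,z,x,y)$. A normal representation is a representation that is square, homogeneous and fully universal (every atomic closed network satisfiable in it). The atom structure $\mathfrak A_0$ has domain $A_0$, a unary relation for every subset of $A_0$, the binary relation $\{(a_1,a_2)\mid\breve{a_1}=a_2\}$, and $R$. The binarisation $\mathfrak A_0^b$ has domain $A_0$, unary relations $U_S$ for all $S\subseteq A_0$, binary relations $R_a=\{(x,y)\mid (a,x,y)\in R\}$ for $a\in A_0$, and every union of relations $R_a$. $\mathrm{Pol}(\mathfrak C)$ is the set of polymorphisms (homomorphisms $\mathfrak C^n\to\mathfrak C$). Edge notions for $\mathfrak A_0^b$: $(a,b)$ is a semilattice edge if some binary polymorphism $p$ has $p(a,b)=p(b,a)=p(b,b)=b$, $p(a,a)=a$; $\{a,b\}$ has a semilattice edge if $(a,b)$ or $(b,a)$ is one; $\{a,b\}$ is a majority edge if it has no semilattice edge and some ternary polymorphism is a majority operation on $\{a,b\}$; it is an affine edge if it is neither but some ternary polymorphism is a minority operation on $\{a,b\}$. A Siggers operation is a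 6-ary $s$ with $s(x,x,y,y,z,z)=s(y,z,x,z,x,y)$. -}

module Defs where

open import Data.Nat using (ℕ)
open import Data.Fin using (Fin; _≟_)
open import Data.Fin.Properties using (all?)
open import Data.Bool using (Bool; true)
open import Data.Product using (Σ; ∃; ∃-syntax; _×_; _,_; proj₁)
open import Data.Sum using (_⊎_)
open import Data.Vec.Functional using (Vector; _∷_; [])
open import Data.Empty using (⊥)
open import Function.Bundles using (_⇔_; _↔_; Inverse)
open import Relation.Nullary using (¬_; Dec)
open import Relation.Nullary.Decidable using (True; _×-dec_; _⊎-dec_; _→-dec_; ¬?)
open import Relation.Binary.PropositionalEquality using (_≡_; _≢_)

record RelAlg (n : ℕ) : Set where
  infixl 6 _∪_
  infixl 7 _⨾_
  field
    _∪_ : Fin n → Fin n → Fin n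
    ‾_  : Fin n → Fin n
    𝟘 𝟙 ı : Fin n
    _˘  : Fin n → Fin n
    _⨾_ : Fin n → Fin n → Fin n
    ∪-comm     : ∀ x y → x ∪ y ≡ y ∪ x
    ∪-assoc    : ∀ x y z → (x ∪ y) ∪ z ≡ x ∪ (y ∪ z)
    huntington : ∀ x y → x ≡ ‾ (‾ x ∪ ‾ y) ∪ ‾ (‾ x ∪ y)
    𝟙-def      : ∀ x → 𝟙 ≡ x ∪ ‾ x
    𝟘-def      : ∀ x → 𝟘 ≡ ‾ (x ∪ ‾ x)
    ⨾-assoc    : ∀ x y z → (x ⨾ y) ⨾ z ≡ x ⨾ (y ⨾ z)
    ⨾-distribʳ : ∀ x y z → (x ∪ y) ⨾ z ≡ x ⨾ z ∪ y ⨾ z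
    ⨾-identityʳ : ∀ x → x ⨾ ı ≡ x
    ˘-involutive : ∀ x → (x ˘) ˘ ≡ x
    ˘-∪        : ∀ x y → (x ∪ y) ˘ ≡ x ˘ ∪ y ˘
    ˘-⨾        : ∀ x y → (x ⨾ y) ˘ ≡ y ˘ ⨾ x ˘
    tarski     : ∀ x y → (x ˘ ⨾ ‾ (x ⨾ y)) ∪ ‾ y ≡ ‾ y

module Alg {n : ℕ} (A : RelAlg n) where
  open RelAlg A public

  _≤_ : Fin n → Fin n → Set
  a ≤ b = a ∪ b ≡ b

  _≤?_ : ∀ a b → Dec (a ≤ b)
  a ≤? b = (a ∪ b) ≟ b

  Symmetric : Set
  Symmetric = ∀ a → a ˘ ≡ a

  IsAtom : Fin n → Set
  IsAtom a = a ≢ 𝟘 × (∀ b → b ≤ a → (b ≡ 𝟘 ⊎ b ≡ a))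

  isAtom? : ∀ a → Dec (IsAtom a)
  isAtom? a = ¬? (a ≟ 𝟘) ×-dec all? (λ b → (b ≤? a) →-dec ((b ≟ 𝟘) ⊎-dec (b ≟ a)))

  -- the set A₀ of atoms (membership proof is proof-irrelevant)
  Atom : Set
  Atom = Σ (Fin n) (λ a → True (isAtom? a))

  R : Atom → Atom → Atom → Set
  R x y z = proj₁ z ≤ (proj₁ x ⨾ proj₁ y)

  All1Cycles : Set
  All1Cycles = ∀ (a : Atom) → R a a a

  Op : ℕ → Set
  Op k = Vector Atom k → Atom

  RelOn : ℕ → Set₁
  RelOn r = Vector Atom r → Set

  Preserves : ∀ {k r} → Op k → RelOn r → Set
  Preserves {k} {r} f P =
    ∀ (M : Fin k → Fin r → Atom) → (∀ i → P (M i)) → P (λ j → f (λ i → M i j))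

  record Structure : Set₁ where
    field
      Sym   : Set
      arity : Sym → ℕ
      rel   : (s : Sym) → RelOn (arity s)

  Pol : Structure → ∀ {k} → Op k → Set
  Pol 𝔖 f = ∀ s → Preserves f (Structure.rel 𝔖 s)

  Subset : Set
  Subset = Atom → Bool

  data Sym₀ : Set where
    unary : Subset → Sym₀
    conv  : Sym₀
    tern  : Sym₀

  𝔄₀ : Structure
  𝔄₀ = record { Sym = Sym₀ ; arity = ar ; rel = rl }
    where
    ar : Sym₀ → ℕ
    ar (unary _) = 1
    ar conv = 2
    ar tern = 3
    rl : (s : Sym₀) → RelOn (ar s)
    rl (unary S) t = S (t Fin.zero) ≡ true
    rl conv t = proj₁ (t Fin.zero) ˘ ≡ proj₁ (t (Fin.suc Fin.zero))
    rl tern t = R (t Fin.zero) (t (Fin.suc Fin.zero)) (t (Fin.suc (Fin.suc Fin.zero)))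

  data Symᵇ : Set where
    unary : Subset → Symᵇ
    Rₐ    : Atom → Symᵇ
    union : Subset → Symᵇ

  𝔄₀ᵇ : Structure
  𝔄₀ᵇ = record { Sym = Symᵇ ; arity = ar ; rel = rl }
    where
    ar : Symᵇ → ℕ
    ar (unary _) = 1
    ar (Rₐ _) = 2
    ar (union _) = 2
    rl : (s : Symᵇ) → RelOn (ar s)
    rl (unary S) t = S (t Fin.zero) ≡ true
    rl (Rₐ a) t = R a (t Fin.zero) (t (Fin.suc Fin.zero))
    rl (union T) t = ∃[ a ] (T a ≡ true × R a (t Fin.zero) (t (Fin.suc Fin.zero)))

  ap2 : Op 2 → Atom → Atom → Atom
  ap2 f x y = f (x ∷ y ∷ [])

  ap3 : Op 3 → Atom → Atom → Atom → Atom
  ap3 f x y z = f (x ∷ y ∷ z ∷ [])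

  ap6 : Op 6 → Atom → Atom → Atom → Atom → Atom → Atom → Atom
  ap6 f x₁ x₂ x₃ x₄ x₅ x₆ = f (x₁ ∷ x₂ ∷ x₃ ∷ x₄ ∷ x₅ ∷ x₆ ∷ [])

  SiggersIdentity : Op 6 → Set
  SiggersIdentity s = ∀ x y z → ap6 s x x y y z z ≡ ap6 s y z x z x y

  SiggersBehaviour : Set
  SiggersBehaviour = Σ (Op 6) λ s →
      (∀ (M : Fin 6 → Fin 3 → Atom) →
         (∀ i → R (M i Fin.zero) (M i (Fin.suc Fin.zero)) (M i (Fin.suc (Fin.suc Fin.zero)))) →
         R (s (λ i → M i Fin.zero)) (s (λ i → M i (Fin.suc Fin.zero)))
           (s (λ i → M i (Fin.suc (Fin.suc Fin.zero)))))
    × (∀ (x : Vector Atom 6) → ∃[ i ] s x ≡ x i)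
    × SiggersIdentity s

  SemilatticeEdge : Atom → Atom → Set
  SemilatticeEdge a b = Σ (Op 2) λ p → Pol 𝔄₀ᵇ p
    × ap2 p a b ≡ b × ap2 p b a ≡ b × ap2 p b b ≡ b × ap2 p a a ≡ a

  HasSemilatticeEdge : Atom → Atom → Set
  HasSemilatticeEdge a b = SemilatticeEdge a b ⊎ SemilatticeEdge b a

  _∈⟨_,_⟩ : Atom → Atom → Atom → Set
  x ∈⟨ a , b ⟩ = x ≡ a ⊎ x ≡ b

  IsMajorityOn : Op 3 → Atom → Atom → Set
  IsMajorityOn m a b = ∀ x y → x ∈⟨ a , b ⟩ → y ∈⟨ a , b ⟩ →
    ap3 m x x y ≡ x × ap3 m x y x ≡ x × ap3 m y x x ≡ x

  IsMinorityOn : Op 3 → Atom → Atom → Set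
  IsMinorityOn m a b = ∀ x y → x ∈⟨ a , b ⟩ → y ∈⟨ a , b ⟩ →
    ap3 m x x y ≡ y × ap3 m x y x ≡ y × ap3 m y x x ≡ y

  IsSemilatticeOn : Op 2 → Atom → Atom → Set
  IsSemilatticeOn p a b =
      (∀ x y → x ∈⟨ a , b ⟩ → y ∈⟨ a , b ⟩ → ap2 p x y ∈⟨ a , b ⟩)
    × (∀ x → x ∈⟨ a , b ⟩ → ap2 p x x ≡ x)
    × (∀ x y → x ∈⟨ a , b ⟩ → y ∈⟨ a , b ⟩ → ap2 p x y ≡ ap2 p y x)
    × (∀ x y z → x ∈⟨ a , b ⟩ → y ∈⟨ a , b ⟩ → z ∈⟨ a , b ⟩ →
         ap2 p (ap2 p x y) z ≡ ap2 p x (ap2 p y z))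

  MajorityEdge : Atom → Atom → Set
  MajorityEdge a b = ¬ HasSemilatticeEdge a b
    × Σ (Op 3) (λ m → Pol 𝔄₀ᵇ m × IsMajorityOn m a b)

  AffineEdge : Atom → Atom → Set
  AffineEdge a b = ¬ HasSemilatticeEdge a b × ¬ MajorityEdge a b
    × Σ (Op 3) (λ m → Pol 𝔄₀ᵇ m × IsMinorityOn m a b)

  NoAffineEdge : Set
  NoAffineEdge = ∀ a b → a ≢ b → ¬ AffineEdge a b

  record Representation : Set₁ where
    field
      D : Set
      ρ : Fin n → D → D → Set
      ρ-∪  : ∀ a b x y → ρ (a ∪ b) x y ⇔ (ρ a x y ⊎ ρ b x y)
      ρ-‾  : ∀ a x y → ρ (‾ a) x y ⇔ (¬ ρ a x y)
      ρ-𝟘  : ∀ x y → ¬ ρ 𝟘 x y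
      ρ-𝟙  : ∀ x y → ρ 𝟙 x y
      ρ-ı  : ∀ x y → ρ ı x y ⇔ (x ≡ y)
      ρ-˘  : ∀ a x y → ρ (a ˘) x y ⇔ ρ a y x
      ρ-⨾  : ∀ a b x y → ρ (a ⨾ b) x y ⇔ (∃[ z ] (ρ a x z × ρ b z y))
      ρ-injective : ∀ a b → (∀ x y → ρ a x y ⇔ ρ b x y) → a ≡ b

    record Automorphism : Set where
      field
        α : D ↔ D
        preserves : ∀ a x y → ρ a x y ⇔ ρ a (Inverse.to α x) (Inverse.to α y)

    Homogeneous : Set
    Homogeneous = ∀ (m : ℕ) (g h : Fin m → D) →
      (∀ a i j → ρ a (g i) (g j) ⇔ ρ a (h i) (h j)) →
      Σ Automorphism (λ σ → ∀ i → Inverse.to (Automorphism.α σ) (g i) ≡ h i)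

  AtomicNetwork : ℕ → Set
  AtomicNetwork m = Fin m → Fin m → Atom

  Closed : ∀ {m} → AtomicNetwork m → Set
  Closed N = (∀ i → proj₁ (N i i) ≤ ı)
           × (∀ i j → proj₁ (N j i) ≡ proj₁ (N i j) ˘)
           × (∀ i j k → proj₁ (N i k) ≤ (proj₁ (N i j) ⨾ proj₁ (N j k)))

  FullyUniversal : Representation → Set
  FullyUniversal 𝔅 = ∀ (m : ℕ) (N : AtomicNetwork m) → Closed N →
    Σ (Fin m → D) (λ h → ∀ i j → ρ (proj₁ (N i j)) (h i) (h j))
    where open Representation 𝔅

  -- a normal representation: square (built into Representation: ‾ is
  -- complement in D × D and 𝟙 is D × D), homogeneous, fully universal
  HasNormalRepresentation : Set₁
  HasNormalRepresentation = Σ Representation λ 𝔅 →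
    Representation.Homogeneous 𝔅 × FullyUniversal 𝔅

  uOp : Op 2 → Op 3 → Op 3
  uOp v w t = ap3 w (ap2 v (ap2 v x y) z) (ap2 v (ap2 v y z) x) (ap2 v (ap2 v z x) y)
    where
    x = t Fin.zero
    y = t (Fin.suc Fin.zero)
    z = t (Fin.suc (Fin.suc Fin.zero))

{-# OPTIONS --safe #-}

-- A binary polymorphism of the binarisation preserves R, which is invariant under
-- permutations of the coordinates. So let o be the image under u of three triples of R and
-- suppose o ∉ R. As u preserves the unions of the relations Rₐ, each coordinate of o can be
-- replaced by an entry of its column so that the result lies in R.
--
-- If no replacement involves a semilattice edge, then the Siggers behaviour gives on each
-- of the three pairs a majority or a minority operation, and only the case is possible that
-- all three are affine and R is a parity relation on them. The 2-cycles (x,x,y) between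
-- elements of different pairs, together with the 1-cycles, contradict this.
--
-- Otherwise use that u chooses in each column an element that is not below any other in the
-- semilattice order of v, unless the column is a rock-paper-scissors algebra under v. For
-- such columns there are terms in v that produce o from the three triples and the three
-- replacements.
module Submission where

open import Defs
open import Data.Nat using (ℕ)
open import Data.Bool using (true; false; if_then_else_)
open import Data.Bool.Properties using (T-irrelevant; if-float)
open import Data.Fin using (Fin)
import Data.Fin as Fin
open import Data.Fin.Patterns using (0F; 1F; 2F; 3F; 4F; 5F)
open import Data.Fin.Properties using (all?; any?)
open import Data.Vec.Functional using (Vector; _∷_; [])
open import Data.Product using (Σ; ∃-syntax; _×_; _,_; proj₁; proj₂)
open import Data.Sum using (_⊎_; inj₁; inj₂; swap)
open import Data.Empty using (⊥; ⊥-elim)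
open import Function.Bundles using (Equivalence; mk⇔)
open import Relation.Nullary using (¬_; Dec; yes; no; does)
open import Relation.Nullary.Decidable
  using (toWitness; from-yes; decidable-stable; map′; ¬?; _×-dec_; _→-dec_)
open import Relation.Binary.PropositionalEquality
  using (_≡_; _≢_; refl; sym; trans; cong; cong₂; subst)
open import Relation.Binary.Definitions using (DecidableEquality)

-- Terms over the rock-paper-scissors algebra.

data Term : Set where
  row point : Fin 3 → Term
  _⊗_ : Term → Term → Term

-- `row i` will stand for the i-th given triple of R, `point i` for the value of u with its i-th
-- coordinate replaced.
eval : {A : Set} → (A → A → A) → (Fin 3 → A) → (Fin 3 → A) → Term → A
eval _∙_ ρ ν (row i)   = ρ i
eval _∙_ ρ ν (point i) = ν i
eval _∙_ ρ ν (s ⊗ t)   = eval _∙_ ρ ν s ∙ eval _∙_ ρ ν t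

-- Where o absorbs every leaf from the left, a term has the value o as soon as its leftmost leaf
-- does.
LeftmostPoint : Fin 3 → Term → Set
LeftmostPoint i (row _)   = ⊥
LeftmostPoint i (point j) = j ≡ i
LeftmostPoint i (s ⊗ t)   = LeftmostPoint i s

triple : {A : Set} → A → A → A → Fin 3 → A
triple x y z 0F = x
triple x y z 1F = y
triple x y z 2F = z

-- The line through o in direction p, evaluated at b.
at : {A : Set} → Fin 3 → A → A → Fin 3 → A
at p b o j = if does (j Fin.≟ p) then b else o

next : Fin 3 → Fin 3
next 0F = 1F
next 1F = 2F
next 2F = 0F

-- The rock-paper-scissors operation, in which next i beats i.
_⊙_ : Fin 3 → Fin 3 → Fin 3
0F ⊙ 1F = 1F
1F ⊙ 2F = 2F
2F ⊙ 0F = 0F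
i ⊙ _ = i

Distinct : Fin 3 → Fin 3 → Fin 3 → Set
Distinct i j k = i ≢ j × j ≢ k × k ≢ i

distinct? : ∀ i j k → Dec (Distinct i j k)
distinct? i j k = ¬? (i Fin.≟ j) ×-dec ¬? (j Fin.≟ k) ×-dec ¬? (k Fin.≟ i)

-- Found by computer search.
pred : Term → Term
pred t = (((r₂ ⊗ (r₁ ⊗ t)) ⊗ (r₃ ⊗ (r₁ ⊗ t))) ⊗ r₁) ⊗ (((r₂ ⊗ (r₃ ⊗ t)) ⊗ (r₁ ⊗ (r₃ ⊗ t))) ⊗ r₃)
  where
  r₁ = row 0F
  r₂ = row 1F
  r₃ = row 2F

-- Unlike pred (pred t), which has the same values, it has the leftmost leaf of t.
succ : Term → Term
succ t = t ⊗ pred (pred t)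

-- The value of `pred t` depends on `t` only through the value of `t`, so a point may take its place
-- and finitely many cases remain.
pred-⊙ : ∀ i j k → Distinct i j k → ∀ {ν} t →
  eval _⊙_ (triple i j k) ν (pred t) ≡ next (next (eval _⊙_ (triple i j k) ν t))
pred-⊙ i j k d {ν} t = check i j k d (eval _⊙_ (triple i j k) ν t)
  where
  check : ∀ i j k → Distinct i j k → ∀ m →
    eval _⊙_ (triple i j k) (λ _ → m) (pred (point 0F)) ≡ next (next m)
  check = from-yes (all? λ i → all? λ j → all? λ k → distinct? i j k →-dec all? λ m →
    eval _⊙_ (triple i j k) (λ _ → m) (pred (point 0F)) Fin.≟ next (next m))

next³ : ∀ i → next (next (next i)) ≡ i
next³ 0F = refl
next³ 1F = refl
next³ 2F = refl

⊙-next : ∀ i → i ⊙ next i ≡ next i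
⊙-next 0F = refl
⊙-next 1F = refl
⊙-next 2F = refl

module _ {i j k} (d : Distinct i j k) {ν : Fin 3 → Fin 3} where

  private
    ⟦_⟧ : Term → Fin 3
    ⟦_⟧ = eval _⊙_ (triple i j k) ν

  pred²-⊙ : ∀ t → ⟦ pred (pred t) ⟧ ≡ next ⟦ t ⟧
  pred²-⊙ t = trans (pred-⊙ i j k d (pred t))
    (trans (cong (λ m → next (next m)) (pred-⊙ i j k d t)) (cong next (next³ ⟦ t ⟧)))

  succ-⊙ : ∀ t → ⟦ succ t ⟧ ≡ next ⟦ t ⟧
  succ-⊙ t = trans (cong (⟦ t ⟧ ⊙_) (pred²-⊙ t)) (⊙-next ⟦ t ⟧)

  succ²-⊙ : ∀ t → ⟦ succ (succ t) ⟧ ≡ next (next ⟦ t ⟧)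
  succ²-⊙ t = trans (succ-⊙ (succ t)) (cong next (succ-⊙ t))

-- Abstract because unfolding these large terms is slow.
abstract

  -- On three rock-paper-scissors columns with the points (1,0,0), (0,1,0), (0,0,1), the
  -- three factors are (0,2,2), (2,0,2), (2,2,0).
  meet-up : Term
  meet-up = (succ (succ (point 0F)) ⊗ succ (succ (point 1F))) ⊗ succ (succ (point 2F))

  -- On three rock-paper-scissors columns with the points (2,0,0), (0,1,0), (0,0,1), the
  -- first two factors are (0,2,1) and (0,1,2).
  meet-down : Term
  meet-down = ((pred (pred (point 0F)) ⊗ pred (point 2F)) ⊗
               (pred (pred (point 0F)) ⊗ pred (point 1F))) ⊗ point 0F

  meet-up-leftmost : LeftmostPoint 0F meet-up
  meet-up-leftmost = refl

  eval-meet-up : ∀ {i j k} → Distinct i j k → ∀ ν → eval _⊙_ (triple i j k) ν meet-up ≡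
    (next (next (ν 0F)) ⊙ next (next (ν 1F))) ⊙ next (next (ν 2F))
  eval-meet-up d ν = cong₂ _⊙_
    (cong₂ _⊙_ (succ²-⊙ d {ν} (point 0F)) (succ²-⊙ d {ν} (point 1F))) (succ²-⊙ d {ν} (point 2F))

  eval-meet-down : ∀ {i j k} → Distinct i j k → ∀ ν → eval _⊙_ (triple i j k) ν meet-down ≡
    ((next (ν 0F) ⊙ next (next (ν 2F))) ⊙ (next (ν 0F) ⊙ next (next (ν 1F)))) ⊙ ν 0F
  eval-meet-down {i} {j} {k} d ν = cong (_⊙ ν 0F) (cong₂ _⊙_
    (cong₂ _⊙_ (pred²-⊙ d {ν} (point 0F)) (pred-⊙ i j k d {ν} (point 2F)))
    (cong₂ _⊙_ (pred²-⊙ d {ν} (point 0F)) (pred-⊙ i j k d {ν} (point 1F))))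

-- In every column the factors are one 0 and two 2s, and 0 beats 2.
meet-up-⊙ : ∀ {i j k} → Distinct i j k → ∀ p →
  eval _⊙_ (triple i j k) (at p 1F 0F) meet-up ≡ 0F
meet-up-⊙ d 0F = eval-meet-up d (at 0F 1F 0F)
meet-up-⊙ d 1F = eval-meet-up d (at 1F 1F 0F)
meet-up-⊙ d 2F = eval-meet-up d (at 2F 1F 0F)

-- The first two factors multiply to (0,2,2), since 2 beats 1; the last factor (2,0,0) turns this
-- into (0,0,0), since 0 beats 2.
meet-down-⊙ : ∀ {i j k} → Distinct i j k → ∀ p →
  eval _⊙_ (triple i j k) (at p (triple 2F 1F 1F p) 0F) meet-down ≡ 0F
meet-down-⊙ d 0F = eval-meet-down d (at 0F 2F 0F)
meet-down-⊙ d 1F = eval-meet-down d (at 1F 1F 0F)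
meet-down-⊙ d 2F = eval-meet-down d (at 2F 1F 0F)

-- Conservative operations preserving a symmetric ternary relation.

module TernaryRelation
  {X : Set} (R : X → X → X → Set)
  (swap₁₂ : ∀ {x y z} → R x y z → R y x z)
  (swap₂₃ : ∀ {x y z} → R x y z → R x z y)
  where

  -- Conservativity is stated as preservation of all predicates, so that it passes to compositions
  -- and minors without naming the chosen argument.
  record Binary : Set₁ where
    field
      op   : X → X → X
      cons : (P : X → Set) → ∀ {x y} → P x → P y → P (op x y)
      pres : ∀ {x₁ x₂ x₃ y₁ y₂ y₃} → R x₁ x₂ x₃ → R y₁ y₂ y₃ →
             R (op x₁ y₁) (op x₂ y₂) (op x₃ y₃)

    idem : ∀ x → op x x ≡ x
    idem x = cons (_≡ x) refl refl

    choice : ∀ x y → op x y ≡ x ⊎ op x y ≡ y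
    choice x y = cons (λ t → t ≡ x ⊎ t ≡ y) (inj₁ refl) (inj₂ refl)

  record Ternary : Set₁ where
    field
      op   : X → X → X → X
      cons : (P : X → Set) → ∀ {x y z} → P x → P y → P z → P (op x y z)
      pres : ∀ {x₁ x₂ x₃ y₁ y₂ y₃ z₁ z₂ z₃} →
             R x₁ x₂ x₃ → R y₁ y₂ y₃ → R z₁ z₂ z₃ →
             R (op x₁ y₁ z₁) (op x₂ y₂ z₂) (op x₃ y₃ z₃)

    idem : ∀ x → op x x x ≡ x
    idem x = cons (_≡ x) refl refl refl

  record Siggers : Set₁ where
    field
      op   : X → X → X → X → X → X → X
      cons : (P : X → Set) → ∀ {x₁ x₂ x₃ x₄ x₅ x₆} →
             P x₁ → P x₂ → P x₃ → P x₄ → P x₅ → P x₆ → P (op x₁ x₂ x₃ x₄ x₅ x₆)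
      pres : ∀ {x₁ x₂ x₃ x₄ x₅ x₆ y₁ y₂ y₃ y₄ y₅ y₆ z₁ z₂ z₃ z₄ z₅ z₆} →
             R x₁ y₁ z₁ → R x₂ y₂ z₂ → R x₃ y₃ z₃ →
             R x₄ y₄ z₄ → R x₅ y₅ z₅ → R x₆ y₆ z₆ →
             R (op x₁ x₂ x₃ x₄ x₅ x₆) (op y₁ y₂ y₃ y₄ y₅ y₆) (op z₁ z₂ z₃ z₄ z₅ z₆)
      identity : ∀ x y z → op x x y y z z ≡ op y z x z x y

  rot : ∀ {x y z} → R x y z → R y z x
  rot r = swap₂₃ (swap₁₂ r)

  rot⁻¹ : ∀ {x y z} → R x y z → R z x y
  rot⁻¹ r = swap₁₂ (swap₂₃ r)

  R-resp : ∀ {x y z x′ y′ z′} → x ≡ x′ → y ≡ y′ → z ≡ z′ → R x y z → R x′ y′ z′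
  R-resp refl refl refl r = r

  flip : Binary → Binary
  flip g = record
    { op = λ x y → op y x ; cons = λ P p q → cons P q p ; pres = λ r s → pres s r }
    where
    open Binary g

  module _ (f : Ternary) where
    open Ternary f

    minor₁ minor₂ minor₃ : Binary
    minor₁ = record { op = λ x y → op x y y ; cons = λ P p q → cons P p q q
                    ; pres = λ r s → pres r s s }
    minor₂ = record { op = λ x y → op y x y ; cons = λ P p q → cons P q p q
                    ; pres = λ r s → pres s r s }
    minor₃ = record { op = λ x y → op y y x ; cons = λ P p q → cons P q q p
                    ; pres = λ r s → pres s s r }

    iterate₃ : Ternary
    iterate₃ = record
      { op = λ x y z → op x y (op x y z)
      ; cons = λ P p q r → cons P p q (cons P p q r)
      ; pres = λ r s t → pres r s (pres r s t) }

  -- The property that preserving all unions of the relations R a gives to an operation.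
  Neighbour : (X → X → X) → Set
  Neighbour f = ∀ {x₁ x₂ x₃ y₁ y₂ y₃} → R x₁ x₂ x₃ → R y₁ y₂ y₃ →
    R x₁ (f x₂ y₂) (f x₃ y₃) ⊎ R y₁ (f x₂ y₂) (f x₃ y₃)

  module _ {f : X → X → X} (neighbour : Neighbour f) where

    neighbour-fixed : ∀ {a x₂ x₃ y₂ y₃} → R a x₂ x₃ → R a y₂ y₃ → R a (f x₂ y₂) (f x₃ y₃)
    neighbour-fixed r s with neighbour r s
    ... | inj₁ t = t
    ... | inj₂ t = t

    -- Freeing the second coordinate gives (x₁,x₂,y₃) at once or (x₁,y₂,y₃). The latter shares x₁
    -- with `r`, and `f` preserves the relation `R x₁`.
    neighbour-mixed : ∀ {x₁ x₂ x₃ y₁ y₂ y₃} → R x₁ x₂ x₃ → R y₁ y₂ y₃ →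
      f x₁ y₁ ≡ x₁ → f x₂ y₂ ≡ x₂ → f x₃ y₃ ≡ y₃ → R (f x₁ y₁) (f x₂ y₂) (f x₃ y₃)
    neighbour-mixed r s e₁ e₂ e₃ with neighbour (swap₁₂ r) (swap₁₂ s)
    ... | inj₁ t = R-resp refl (sym e₂) refl (swap₁₂ t)
    ... | inj₂ t = R-resp (sym e₁) refl refl
                     (neighbour-fixed r (R-resp e₁ refl e₃ (swap₁₂ t)))

  -- If the values do not all come from one triple, two come from one and the third from the other.
  -- Permuting coordinates and exchanging arguments reduces this to `neighbour-mixed`.
  neighbour⇒pres : (f : X → X → X) → (∀ x y → f x y ≡ x ⊎ f x y ≡ y) → Neighbour f →
    ∀ {x₁ x₂ x₃ y₁ y₂ y₃} → R x₁ x₂ x₃ → R y₁ y₂ y₃ → R (f x₁ y₁) (f x₂ y₂) (f x₃ y₃)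
  neighbour⇒pres f choice neighbour {x₁} {x₂} {x₃} {y₁} {y₂} {y₃} r s
    with choice x₁ y₁ | choice x₂ y₂ | choice x₃ y₃
  ... | inj₁ e₁ | inj₁ e₂ | inj₁ e₃ = R-resp (sym e₁) (sym e₂) (sym e₃) r
  ... | inj₂ e₁ | inj₂ e₂ | inj₂ e₃ = R-resp (sym e₁) (sym e₂) (sym e₃) s
  ... | inj₁ e₁ | inj₁ e₂ | inj₂ e₃ = neighbour-mixed {f} neighbour r s e₁ e₂ e₃
  ... | inj₁ e₁ | inj₂ e₂ | inj₁ e₃ =
    swap₂₃ (neighbour-mixed {f} neighbour (swap₂₃ r) (swap₂₃ s) e₁ e₃ e₂)
  ... | inj₂ e₁ | inj₁ e₂ | inj₁ e₃ =
    rot⁻¹ (neighbour-mixed {f} neighbour (rot r) (rot s) e₂ e₃ e₁)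
  ... | inj₂ e₁ | inj₂ e₂ | inj₁ e₃ =
    neighbour-mixed {λ x y → f y x} (λ r s → swap (neighbour s r)) s r e₁ e₂ e₃
  ... | inj₂ e₁ | inj₁ e₂ | inj₂ e₃ =
    swap₂₃ (neighbour-mixed {λ x y → f y x} (λ r s → swap (neighbour s r))
             (swap₂₃ s) (swap₂₃ r) e₁ e₃ e₂)
  ... | inj₁ e₁ | inj₂ e₂ | inj₂ e₃ =
    rot⁻¹ (neighbour-mixed {λ x y → f y x} (λ r s → swap (neighbour s r))
             (rot s) (rot r) e₂ e₃ e₁)

  -- Pairs on which `v` is a projection, and their types.

  module Rigidity
    (R? : ∀ x y z → Dec (R x y z))
    (R-refl : ∀ x → R x x x)
    (v : Binary)
    (dichotomy : ∀ x y → (Binary.op v x y ≡ x × Binary.op v y x ≡ y) ⊎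
      Binary.op v x y ≡ Binary.op v y x)
    (rigid : ∀ {x y} → x ≢ y → Binary.op v x y ≡ x → Binary.op v y x ≡ y →
      (g : Binary) → Binary.op g x y ≢ Binary.op g y x)
    (_≟_ : DecidableEquality X)
    (siggers : Siggers)
    where

    open Binary v public using () renaming
      (op to infixl 7 _·_; cons to ·-cons; pres to ·-pres; idem to ·-idem; choice to ·-choice)

    infix 4 _⊑_ _∥_

    -- An order on each pair only: transitivity fails on a rock-paper-scissors algebra.
    _⊑_ : X → X → Set
    x ⊑ y = x · y ≡ y × y · x ≡ y

    _∥_ : X → X → Set
    x ∥ y = x ≢ y × x · y ≡ x × y · x ≡ y

    ∥-sym : ∀ {x y} → x ∥ y → y ∥ x
    ∥-sym (x≢y , p , q) = (λ e → x≢y (sym e)) , q , p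

    ⊑-antisym : ∀ {x y} → x ⊑ y → y ⊑ x → x ≡ y
    ⊑-antisym (_ , p) (q , _) = trans (sym q) p

    data Comparison (x y : X) : Set where
      below    : x ⊑ y → Comparison x y
      above    : y ⊑ x → Comparison x y
      parallel : x ∥ y → Comparison x y

    compare : ∀ x y → Comparison x y
    compare x y with x ≟ y
    ... | yes refl = below (·-idem x , ·-idem x)
    ... | no x≢y with dichotomy x y
    ...   | inj₁ (p , q) = parallel (x≢y , p , q)
    ...   | inj₂ p with ·-choice x y
    ...     | inj₁ e = above (trans (sym p) e , e)
    ...     | inj₂ e = below (e , trans (sym p) e)

    -- A conservative operation that is no projection on the pair takes the same value at (x,y) and
    -- (y,x), which `rigid` excludes.
    project : ∀ {x y} → x ∥ y → (g : Binary) → let open Binary g in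
      (op x y ≡ x × op y x ≡ y) ⊎ (op x y ≡ y × op y x ≡ x)
    project {x} {y} (x≢y , p , q) g with Binary.choice g x y | Binary.choice g y x
    ... | inj₁ e | inj₁ e′ = inj₁ (e , e′)
    ... | inj₁ e | inj₂ e′ = ⊥-elim (rigid x≢y p q g (trans e (sym e′)))
    ... | inj₂ e | inj₁ e′ = ⊥-elim (rigid x≢y p q g (trans e (sym e′)))
    ... | inj₂ e | inj₂ e′ = inj₂ (e , e′)

    record Majority (f : Ternary) (x y : X) : Set where
      constructor majority
      open Ternary f
      field
        xyy : op x y y ≡ y
        yxx : op y x x ≡ x
        yxy : op y x y ≡ y
        xyx : op x y x ≡ x
        yyx : op y y x ≡ y
        xxy : op x x y ≡ x

    record Minority (f : Ternary) (x y : X) : Set where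
      constructor minority
      open Ternary f
      field
        xyy : op x y y ≡ x
        yxx : op y x x ≡ y
        yxy : op y x y ≡ x
        xyx : op x y x ≡ y
        yyx : op y y x ≡ x
        xxy : op x x y ≡ y

    Minority-sym : ∀ {f x y} → Minority f x y → Minority f y x
    Minority-sym (minority a b c d e f) = minority b a d c f e

    Typed : X → X → Set₁
    Typed x y = Σ Ternary λ f → Majority f x y ⊎ Minority f x y

    -- If the third minor is the projection to the repeated argument, f is a 2/3-minority, and
    -- substituting f for its last argument makes it a majority.
    typed-from-two-minors : ∀ {x y} → x ∥ y → (f : Ternary) → let open Ternary f in
      op x y y ≡ x → op y x x ≡ y → op y x y ≡ x → op x y x ≡ y → Typed x y
    typed-from-two-minors par f xyy yxx yxy xyx with project par (minor₃ f)
    ... | inj₁ (yyx , xxy) = f , inj₂ (minority xyy yxx yxy xyx yyx xxy)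
    ... | inj₂ (yyx , xxy) = iterate₃ f , inj₁ (majority
          (trans (cong (op _ _) xyy) xyx) (trans (cong (op _ _) yxx) yxy)
          (trans (cong (op _ _) yxy) yxx) (trans (cong (op _ _) xyx) xyy)
          (trans (cong (op _ _) yyx) (idem _)) (trans (cong (op _ _) xxy) (idem _)))
      where
      open Ternary f

    module s = Siggers siggers

    -- At (x,y,y) the operations `s₂`, `s₃`, `s₄` are by definition `s₁` at (x,y,y), (y,x,y),
    -- (y,y,x); at (y,x,y) they are the other sides of the corresponding Siggers identities.
    s₁ s₂ s₃ s₄ : Ternary
    s₁ = record { op = λ a b c → s.op a a b b c c ; cons = λ P p q r → s.cons P p p q q r r
                ; pres = λ p q r → s.pres p p q q r r }
    s₂ = record { op = λ a b c → s.op a a b c b c ; cons = λ P p q r → s.cons P p p q r q r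
                ; pres = λ p q r → s.pres p p q r q r }
    s₃ = record { op = λ a b c → s.op b c a a c b ; cons = λ P p q r → s.cons P q r p p r q
                ; pres = λ p q r → s.pres q r p p r q }
    s₄ = record { op = λ a b c → s.op c b c b a a ; cons = λ P p q r → s.cons P r q r q p p
                ; pres = λ p q r → s.pres r q r q p p }

    -- If s₁ is not a majority on the pair, one of its minors is the projection to the
    -- argument occurring once. By the Siggers identity it is then the minor, in each of
    -- the first two arguments, of s₂, s₃ or s₄.
    typed : ∀ {x y} → x ∥ y → Typed x y
    typed {x} {y} par
      with project par (minor₁ s₁) | project par (minor₂ s₁) | project par (minor₃ s₁)
    ... | inj₁ (e , e′) | _ | _ = typed-from-two-minors par s₂ e e′
            (trans (sym (s.identity x y y)) e) (trans (sym (s.identity y x x)) e′)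
    ... | inj₂ _ | inj₁ (e , e′) | _ = typed-from-two-minors par s₃ e e′
            (trans (sym (s.identity y x y)) e) (trans (sym (s.identity x y x)) e′)
    ... | inj₂ _ | inj₂ _ | inj₁ (e , e′) = typed-from-two-minors par s₄ e e′
            (trans (sym (s.identity y y x)) e) (trans (sym (s.identity x x y)) e′)
    ... | inj₂ (xyy , yxx) | inj₂ (yxy , xyx) | inj₂ (yyx , xxy) =
            s₁ , inj₁ (majority xyy yxx yxy xyx yyx xxy)

    -- Unless y ⊑ x, an operation applied to (x,x,y) and (x,y,x) yields (x,y,y): `v` itself if x ⊑
    -- y, otherwise a majority with third argument (y,y,y) or a minority with third argument
    -- (x,x,x).
    two-cycle : ∀ {x y} → R x x y → R x y y ⊎ y ⊑ x
    two-cycle {x} {y} r with R? x y y | compare y x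
    ... | yes r′ | _ = inj₁ r′
    ... | no _ | below p = inj₂ p
    ... | no ¬r | above (p , q) =
      ⊥-elim (¬r (R-resp (·-idem x) p q (·-pres r (swap₂₃ r))))
    ... | no ¬r | parallel par with typed (∥-sym par)
    ...   | f , inj₁ m = ⊥-elim (¬r (R-resp xxy xyy yxy (pres r (swap₂₃ r) (R-refl y))))
      where
      open Ternary f
      open Majority m
    ...   | f , inj₂ m = ⊥-elim (¬r (R-resp (idem x) xyx yxx (pres r (swap₂₃ r) (R-refl x))))
      where
      open Ternary f
      open Minority m

    -- Parity configurations and their exclusion.

    -- Three parallel pairs on which R is the set of triples with an even number of bs.
    record Parity (a₁ b₁ a₂ b₂ a₃ b₃ : X) : Set₁ where
      field
        par₁ : a₁ ∥ b₁
        par₂ : a₂ ∥ b₂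
        par₃ : a₃ ∥ b₃
        f    : Ternary
        min₁ : Minority f a₁ b₁
        min₂ : Minority f a₂ b₂
        min₃ : Minority f a₃ b₃
        aaa  : R a₁ a₂ a₃
        abb  : R a₁ b₂ b₃
        bab  : R b₁ a₂ b₃
        bba  : R b₁ b₂ a₃
        ¬baa : ¬ R b₁ a₂ a₃
        ¬aba : ¬ R a₁ b₂ a₃
        ¬aab : ¬ R a₁ a₂ b₃
        ¬bbb : ¬ R b₁ b₂ b₃

    module _ {a₁ b₁ a₂ b₂ a₃ b₃ : X} (π : Parity a₁ b₁ a₂ b₂ a₃ b₃) where
      open Parity π

      parity-swap₁₂ : Parity a₂ b₂ a₁ b₁ a₃ b₃
      parity-swap₁₂ = record
        { par₁ = par₂ ; par₂ = par₁ ; par₃ = par₃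
        ; f = f ; min₁ = min₂ ; min₂ = min₁ ; min₃ = min₃
        ; aaa = swap₁₂ aaa ; abb = swap₁₂ bab ; bab = swap₁₂ abb ; bba = swap₁₂ bba
        ; ¬baa = λ r → ¬aba (swap₁₂ r) ; ¬aba = λ r → ¬baa (swap₁₂ r)
        ; ¬aab = λ r → ¬aab (swap₁₂ r) ; ¬bbb = λ r → ¬bbb (swap₁₂ r) }

      parity-swap₂₃ : Parity a₁ b₁ a₃ b₃ a₂ b₂
      parity-swap₂₃ = record
        { par₁ = par₁ ; par₂ = par₃ ; par₃ = par₂
        ; f = f ; min₁ = min₁ ; min₂ = min₃ ; min₃ = min₂
        ; aaa = swap₂₃ aaa ; abb = swap₂₃ abb ; bab = swap₂₃ bba ; bba = swap₂₃ bab
        ; ¬baa = λ r → ¬baa (swap₂₃ r) ; ¬aba = λ r → ¬aab (swap₂₃ r)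
        ; ¬aab = λ r → ¬aba (swap₂₃ r) ; ¬bbb = λ r → ¬bbb (swap₂₃ r) }

      parity-flip₂₃ : Parity a₁ b₁ b₂ a₂ b₃ a₃
      parity-flip₂₃ = record
        { par₁ = par₁ ; par₂ = ∥-sym par₂ ; par₃ = ∥-sym par₃
        ; f = f ; min₁ = min₁ ; min₂ = Minority-sym min₂ ; min₃ = Minority-sym min₃
        ; aaa = abb ; abb = aaa ; bab = bba ; bba = bab
        ; ¬baa = ¬bbb ; ¬aba = ¬aab ; ¬aab = ¬aba ; ¬bbb = ¬baa }

    parity-rot : ∀ {a₁ b₁ a₂ b₂ a₃ b₃} → Parity a₁ b₁ a₂ b₂ a₃ b₃ → Parity a₃ b₃ a₁ b₁ a₂ b₂
    parity-rot π = parity-swap₁₂ (parity-swap₂₃ π)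

    module _ {a₁ b₁ a₂ b₂ a₃ b₃ : X} (π : Parity a₁ b₁ a₂ b₂ a₃ b₃) where
      open Parity π

      -- The product of (a₁,a₁,a₁) and (b₁,a₂,b₃) is (a₁,a₂,a₁) or the excluded (a₁,a₂,b₃).
      ⊑⇒cycle : a₁ ⊑ a₂ → R a₁ a₁ a₂
      ⊑⇒cycle (p , _) with ·-choice a₁ b₃ | ·-pres (R-refl a₁) bab
      ... | inj₁ e | r = swap₂₃ (R-resp (proj₁ (proj₂ par₁)) p e r)
      ... | inj₂ e | r = ⊥-elim (¬aab (R-resp (proj₁ (proj₂ par₁)) p e r))

    cycle-sym : ∀ {a₁ b₁ a₂ b₂ a₃ b₃} → Parity a₁ b₁ a₂ b₂ a₃ b₃ → R a₁ a₁ a₂ → R a₂ a₂ a₁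
    cycle-sym π r with two-cycle r
    ... | inj₁ r′ = rot r′
    ... | inj₂ p  = ⊑⇒cycle (parity-swap₁₂ π) p

    ⊒⇒cycle : ∀ {a₁ b₁ a₂ b₂ a₃ b₃} → Parity a₁ b₁ a₂ b₂ a₃ b₃ → a₂ ⊑ a₁ → R a₁ a₁ a₂
    ⊒⇒cycle π p = cycle-sym (parity-swap₁₂ π) (⊑⇒cycle (parity-swap₁₂ π) p)

    acyclic⇒∥ : ∀ {a₁ b₁ a₂ b₂ a₃ b₃} → Parity a₁ b₁ a₂ b₂ a₃ b₃ → ¬ R a₁ a₁ a₂ → a₁ ∥ a₂
    acyclic⇒∥ {a₁} {a₂ = a₂} π ¬r with compare a₁ a₂
    ... | below p = ⊥-elim (¬r (⊑⇒cycle π p))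
    ... | above p = ⊥-elim (¬r (⊒⇒cycle π p))
    ... | parallel p = p

    -- Otherwise R a₁ is the graph of a bijection between {a₁ , a₂} and {a₁ , a₃}, so an
    -- operation has the same type on both, and R on {a₁ , a₂ , a₃} looks like the lines
    -- of ℤ/3, which neither a majority nor a minority operation preserves.
    cycle-exists : ∀ {a₁ b₁ a₂ b₂ a₃ b₃} → Parity a₁ b₁ a₂ b₂ a₃ b₃ → R a₁ a₁ a₂ ⊎ R a₁ a₁ a₃
    cycle-exists {a₁} {_} {a₂} {_} {a₃} π with R? a₁ a₁ a₂ | R? a₁ a₁ a₃
    ... | yes r | _ = inj₁ r
    ... | no _ | yes r = inj₂ r
    ... | no ¬r | no ¬r′ with typed (acyclic⇒∥ π ¬r)
    ...   | f , inj₁ m = ⊥-elim (contra (cons (λ t → t ≡ a₁ ⊎ t ≡ a₃) (inj₁ refl) (inj₂ refl) (inj₂ refl)))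
      where
      open Ternary f
      open Majority m
      aaa = Parity.aaa π
      contra : op a₁ a₃ a₃ ≡ a₁ ⊎ op a₁ a₃ a₃ ≡ a₃ → ⊥
      contra (inj₁ e) = ¬r (swap₂₃ (R-resp (idem a₁) xyy e (pres (R-refl a₁) aaa aaa)))
      contra (inj₂ e) = ¬r′ (R-resp xyx xxy e (pres (R-refl a₁) (swap₁₂ aaa) aaa))
    ...   | f , inj₂ m = ⊥-elim (contra (cons (λ t → t ≡ a₁ ⊎ t ≡ a₃) (inj₁ refl) (inj₂ refl) (inj₂ refl)))
      where
      open Ternary f
      open Minority m
      aaa = Parity.aaa π
      contra : op a₁ a₃ a₃ ≡ a₁ ⊎ op a₁ a₃ a₃ ≡ a₃ → ⊥
      contra (inj₁ e) = ¬r (cycle-sym (parity-swap₁₂ π)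
        (R-resp xyx xxy e (pres (R-refl a₁) (swap₁₂ aaa) aaa)))
      contra (inj₂ e) = ¬r′ (R-resp (idem a₁) xyy e (pres (R-refl a₁) aaa aaa))

    -- If a₁ ⊑ a₃, a product gives the excluded (a₁,b₂,a₃). If the two are parallel, avoiding that
    -- triple forces f(a₃,a₃,a₁) = a₁ = f(a₁,a₁,a₃), so a binary minor commutes on the pair.
    cycles⇒⊒₃ : ∀ {a₁ b₁ a₂ b₂ a₃ b₃} → Parity a₁ b₁ a₂ b₂ a₃ b₃ →
      R a₁ a₁ a₂ → R a₁ a₁ b₂ → a₃ ⊑ a₁
    cycles⇒⊒₃ {a₁} {_} {a₂} {b₂} {a₃} π ra rb with compare a₃ a₁
    ... | below p = p
    ... | above (p , _) = ⊥-elim (¬aba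
            (R-resp (·-idem a₁) (proj₂ (proj₂ par₂)) p (·-pres (swap₂₃ rb) aaa)))
      where
      open Parity π
    ... | parallel (a₃≢a₁ , p , q) = ⊥-elim (rigid a₃≢a₁ p q (flip (minor₃ f)) (trans a₃a₃a₁ (sym a₁a₁a₃)))
      where
      open Parity π
      open Ternary f
      open Minority min₂
      a₃a₃a₁ : op a₃ a₃ a₁ ≡ a₁
      a₃a₃a₁ with cons (λ t → t ≡ a₃ ⊎ t ≡ a₁) (inj₁ refl) (inj₁ refl) (inj₂ refl)
      ... | inj₁ e = ⊥-elim (¬aba (R-resp (idem a₁) xxy e (pres aaa aaa (swap₂₃ rb))))
      ... | inj₂ e = e
      a₁a₁a₃ : op a₁ a₁ a₃ ≡ a₁
      a₁a₁a₃ with cons (λ t → t ≡ a₁ ⊎ t ≡ a₃) (inj₁ refl) (inj₁ refl) (inj₂ refl)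
      ... | inj₁ e = e
      ... | inj₂ e = ⊥-elim (¬aba (R-resp (idem a₁) xyx e (pres (swap₂₃ ra) (swap₂₃ rb) aaa)))

    module _ {a₁ b₁ a₂ b₂ a₃ b₃} (π : Parity a₁ b₁ a₂ b₂ a₃ b₃)
             (ra : R a₁ a₁ a₂) (rb : R a₁ a₁ b₂) where

      -- Both a₃ and b₃ lie below a₁, so a₁ has 2-cycles with both, and the second and third pairs
      -- can exchange roles.
      cycles⇒⊒₂ : a₂ ⊑ a₁
      cycles⇒⊒₂ = cycles⇒⊒₃ (parity-swap₂₃ π)
        (⊒⇒cycle (parity-swap₂₃ π) (cycles⇒⊒₃ π ra rb))
        (⊒⇒cycle (parity-swap₂₃ (parity-flip₂₃ π)) (cycles⇒⊒₃ (parity-flip₂₃ π) rb ra))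

    -- A 2-cycle of b₁ with a₂ or b₃ gives that element 2-cycles with both a₁ and b₁. It and a₁ are
    -- then below each other, hence equal, and a 2-cycle of a₁ becomes the excluded (a₁,a₂,b₃).
    cycles⇒⊥ : ∀ {a₁ b₁ a₂ b₂ a₃ b₃} → Parity a₁ b₁ a₂ b₂ a₃ b₃ →
      R a₁ a₁ a₂ → R a₁ a₁ b₂ → ⊥
    cycles⇒⊥ {a₁} {b₁} {a₂} {b₂} {a₃} {b₃} π ra rb with cycle-exists π′
      where
      π′ : Parity b₁ a₁ a₂ b₂ b₃ a₃
      π′ = parity-swap₁₂ (parity-flip₂₃ (parity-swap₁₂ π))
    ... | inj₁ r = ¬aab (R-resp refl a₁≡a₂ refl (⊒⇒cycle (parity-swap₂₃ (parity-flip₂₃ π)) b₃⊑a₁))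
      where
      open Parity π
      b₃⊑a₁ = cycles⇒⊒₃ (parity-flip₂₃ π) rb ra
      a₁≡a₂ : a₁ ≡ a₂
      a₁≡a₂ = ⊑-antisym
        (cycles⇒⊒₂ (parity-swap₁₂ π) (cycle-sym π ra)
          (cycle-sym (parity-swap₁₂ (parity-flip₂₃ (parity-swap₁₂ π))) r))
        (cycles⇒⊒₂ π ra rb)
    ... | inj₂ r = ¬aab (R-resp refl refl a₁≡b₃ (swap₂₃ ra))
      where
      open Parity π
      b₃⊑a₁ = cycles⇒⊒₃ (parity-flip₂₃ π) rb ra
      π₃ : Parity b₃ a₃ a₁ b₁ b₂ a₂
      π₃ = parity-rot (parity-flip₂₃ π)
      a₁≡b₃ : a₁ ≡ b₃
      a₁≡b₃ = ⊑-antisym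
        (cycles⇒⊒₂ π₃ (⊑⇒cycle π₃ b₃⊑a₁)
          (cycle-sym (parity-swap₂₃ (parity-swap₁₂ (parity-flip₂₃ (parity-swap₁₂ π)))) r))
        b₃⊑a₁

    -- Flipping the second and third pairs gives a further 2-cycle of a₁, with b₂ or b₃, which
    -- completes one of these pairs.
    adjacent-cycles⇒⊥ : ∀ {a₁ b₁ a₂ b₂ a₃ b₃} → Parity a₁ b₁ a₂ b₂ a₃ b₃ →
      R a₁ a₁ a₂ → R a₁ a₁ a₃ → ⊥
    adjacent-cycles⇒⊥ π r₂ r₃ with cycle-exists (parity-flip₂₃ π)
    ... | inj₁ r = cycles⇒⊥ π r₂ r
    ... | inj₂ r = cycles⇒⊥ (parity-swap₂₃ π) r₃ r

    -- The 2-cycles form a graph on a₁, a₂, a₃ without isolated vertices, so two of its edges share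
    -- a vertex.
    ¬parity : ∀ {a₁ b₁ a₂ b₂ a₃ b₃} → ¬ Parity a₁ b₁ a₂ b₂ a₃ b₃
    ¬parity π with cycle-exists π | cycle-exists (parity-rot π) | cycle-exists (parity-swap₁₂ π)
    ... | inj₁ r₁₂ | inj₁ r₃₁ | _ = adjacent-cycles⇒⊥ π r₁₂ (cycle-sym (parity-rot π) r₃₁)
    ... | inj₁ r₁₂ | inj₂ r₃₂ | _ = adjacent-cycles⇒⊥ (parity-swap₁₂ π) (cycle-sym π r₁₂)
            (cycle-sym (parity-swap₂₃ (parity-rot π)) r₃₂)
    ... | inj₂ r₁₃ | _ | inj₁ r₂₁ = adjacent-cycles⇒⊥ π (cycle-sym (parity-swap₁₂ π) r₂₁) r₁₃
    ... | inj₂ r₁₃ | _ | inj₂ r₂₃ = adjacent-cycles⇒⊥ (parity-rot π)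
            (cycle-sym (parity-swap₂₃ π) r₁₃) (cycle-sym (parity-swap₂₃ (parity-swap₁₂ π)) r₂₃)

    -- Three replacements parallel to the values.

    Linked : X → X → X → X → Set₁
    Linked x₁ y₁ x₂ y₂ = (g : Binary) → let open Binary g in
      op x₁ y₁ ≡ x₁ → op x₂ y₂ ≡ x₂ × op y₂ x₂ ≡ y₂

    -- An operation projecting differently on the two pairs would combine (a₁,b₂,a₃) and (b₁,a₂,a₃)
    -- to the missing (a₁,a₂,a₃).
    linked : ∀ {a₁ b₁ a₂ b₂ a₃} → a₁ ∥ b₁ → a₂ ∥ b₂ →
      ¬ R a₁ a₂ a₃ → R b₁ a₂ a₃ → R a₁ b₂ a₃ → Linked b₁ a₁ b₂ a₂
    linked {a₁} {b₁} {a₂} {b₂} {a₃} par₁ par₂ ¬r r₁ r₂ g e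
      with project (∥-sym par₁) g | project (∥-sym par₂) g
    ... | inj₂ (e′ , _) | _ = ⊥-elim (proj₁ par₁ (trans (sym e′) e))
    ... | inj₁ _ | inj₁ p = p
    ... | inj₁ (_ , e₁) | inj₂ (e₂ , _) =
            ⊥-elim (¬r (R-resp e₁ e₂ (Binary.idem g a₃) (Binary.pres g r₂ r₁)))

    module _ {x₁ y₁ x₂ y₂} (link : Linked x₁ y₁ x₂ y₂) (f : Ternary) where

      -- Both types are conditions on the three binary minors. Those of a majority are second
      -- projections on the pair, which is why they are flipped below.
      minority-linked : Minority f x₁ y₁ → Minority f x₂ y₂
      minority-linked (minority xyy yxx yxy xyx yyx xxy)
        with link (minor₁ f) xyy | link (minor₂ f) yxy | link (minor₃ f) yyx
      ... | e , e′ | d , d′ | c , c′ = minority e e′ d d′ c c′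

      majority-linked : Majority f x₁ y₁ → Majority f x₂ y₂
      majority-linked (majority xyy yxx yxy xyx yyx xxy)
        with link (flip (minor₁ f)) yxx | link (flip (minor₂ f)) xyx | link (flip (minor₃ f)) xxy
      ... | e , e′ | d , d′ | c , c′ = majority e′ e d′ d c′ c

    -- If (a₁,a₂,a₃) is missing, the pairs are linked and share a type. A majority maps the three
    -- given triples to (a₁,a₂,a₃). A minority maps them to (b₁,b₂,b₃), and maps any triple with
    -- exactly two bs, together with two given ones, to (a₁,a₂,a₃) or, for (b₁,b₂,a₃) and its like,
    -- shows it absent; this is a parity relation once a₁ and b₁ are exchanged.
    ∥-neighbours⇒R : ∀ {a₁ b₁ a₂ b₂ a₃ b₃} → a₁ ∥ b₁ → a₂ ∥ b₂ → a₃ ∥ b₃ →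
      R b₁ a₂ a₃ → R a₁ b₂ a₃ → R a₁ a₂ b₃ → R a₁ a₂ a₃
    ∥-neighbours⇒R {a₁} {b₁} {a₂} {b₂} {a₃} {b₃} par₁ par₂ par₃ r₁ r₂ r₃
      with R? a₁ a₂ a₃ | typed (∥-sym par₁)
    ... | yes r | _ = r
    ... | no ¬r | f , inj₁ m₁ = R-resp (Majority.xyy m₁) (Majority.yxy m₂) (Majority.yyx m₃) (pres r₁ r₂ r₃)
      where
      open Ternary f
      m₂ = majority-linked (linked par₁ par₂ ¬r r₁ r₂) f m₁
      m₃ = majority-linked
        (linked par₁ par₃ (λ r → ¬r (swap₂₃ r)) (swap₂₃ r₁) (swap₂₃ r₃)) f m₁
    ... | no ¬r | f , inj₂ m₁ = ⊥-elim (¬parity (record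
      { par₁ = ∥-sym par₁ ; par₂ = par₂ ; par₃ = par₃
      ; f = f ; min₁ = m₁ ; min₂ = Minority-sym m₂ ; min₃ = Minority-sym m₃
      ; aaa = r₁ ; abb = R-resp M₁.xyy M₂.yxy M₃.yyx (pres r₁ r₂ r₃) ; bab = r₃ ; bba = r₂
      ; ¬baa = ¬r
      ; ¬aba = λ r → ¬r (R-resp M₁.xxy M₂.xyx (idem a₃) (pres r r₁ r₂))
      ; ¬aab = λ r → ¬r (R-resp M₁.xxy (idem a₂) M₃.xyx (pres r r₁ r₃))
      ; ¬bbb = λ r → ¬r (R-resp (idem a₁) M₂.xxy M₃.xyx (pres r r₂ r₃)) }))
      where
      open Ternary f
      m₂ = minority-linked (linked par₁ par₂ ¬r r₁ r₂) f m₁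
      m₃ = minority-linked
        (linked par₁ par₃ (λ r → ¬r (swap₂₃ r)) (swap₂₃ r₁) (swap₂₃ r₃)) f m₁
      module M₁ = Minority m₁
      module M₂ = Minority m₂
      module M₃ = Minority m₃

    -- Columns and the evaluation of terms in them.

    record Cycle (x y z : X) : Set where
      constructor cycle
      field
        x⊑y : x ⊑ y
        y⊑z : y ⊑ z
        z⊑x : z ⊑ x

    triple-⊙ : ∀ {x y z} → Cycle x y z → ∀ i j →
      triple x y z (i ⊙ j) ≡ triple x y z i · triple x y z j
    triple-⊙ c 0F 0F = sym (·-idem _)
    triple-⊙ c 0F 1F = sym (proj₁ (Cycle.x⊑y c))
    triple-⊙ c 0F 2F = sym (proj₂ (Cycle.z⊑x c))
    triple-⊙ c 1F 0F = sym (proj₂ (Cycle.x⊑y c))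
    triple-⊙ c 1F 1F = sym (·-idem _)
    triple-⊙ c 1F 2F = sym (proj₁ (Cycle.y⊑z c))
    triple-⊙ c 2F 0F = sym (proj₁ (Cycle.z⊑x c))
    triple-⊙ c 2F 1F = sym (proj₂ (Cycle.y⊑z c))
    triple-⊙ c 2F 2F = sym (·-idem _)

    -- By `triple-⊙` the labelling is a homomorphism, which transfers computations with labels to
    -- the column.
    eval-cycle : ∀ {x y z} → Cycle x y z → ∀ {ρ ν σ τ} →
      (∀ i → ρ i ≡ triple x y z (σ i)) → (∀ i → ν i ≡ triple x y z (τ i)) →
      ∀ t → eval _·_ ρ ν t ≡ triple x y z (eval _⊙_ σ τ t)
    eval-cycle c p q (row i) = p i
    eval-cycle c p q (point i) = q i
    eval-cycle c p q (s ⊗ t) =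
      trans (cong₂ _·_ (eval-cycle c p q s) (eval-cycle c p q t)) (sym (triple-⊙ c _ _))

    eval-pres : ∀ {ρ₁ ρ₂ ρ₃ ν₁ ν₂ ν₃} → (∀ i → R (ρ₁ i) (ρ₂ i) (ρ₃ i)) →
      (∀ i → R (ν₁ i) (ν₂ i) (ν₃ i)) →
      ∀ t → R (eval _·_ ρ₁ ν₁ t) (eval _·_ ρ₂ ν₂ t) (eval _·_ ρ₃ ν₃ t)
    eval-pres p q (row i) = p i
    eval-pres p q (point i) = q i
    eval-pres p q (s ⊗ t) = ·-pres (eval-pres p q s) (eval-pres p q t)

    module _ {o : X} {ρ ν : Fin 3 → X} (p : ∀ i → o · ρ i ≡ o) (q : ∀ i → o · ν i ≡ o) where

      eval-absorbed : ∀ t → o · eval _·_ ρ ν t ≡ o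
      eval-absorbed (row i) = p i
      eval-absorbed (point i) = q i
      eval-absorbed (s ⊗ t) = ·-cons (λ x → o · x ≡ o) (eval-absorbed s) (eval-absorbed t)

      eval-leftmost : ∀ {i} → ν i ≡ o → ∀ t → LeftmostPoint i t → eval _·_ ρ ν t ≡ o
      eval-leftmost e (point _) refl = e
      eval-leftmost e (s ⊗ t) l = trans (cong (_· _) (eval-leftmost e s l)) (eval-absorbed t)

    -- Here o stands for the value of u on the entries x, y, z, and b for the entry replacing it.
    record Column : Set where
      constructor column
      field
        x y z o b : X

      entry : Fin 3 → X
      entry = triple x y z

      Maximal : Set
      Maximal = ∀ i → o · entry i ≡ o

      -- Labels 0, 1, 2 denote o, the entry c that beats o, and the entry d that o beats. In
      -- `Alternative`, `upward` puts b in the place of c and `downward` in that of d.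
      record Cyclic (c d : X) : Set where
        constructor cyclic
        field
          cyc      : Cycle o c d
          i j k    : Fin 3
          distinct : Distinct i j k
          labelled : ∀ l → entry l ≡ triple o c d (triple i j k l)

      Position : Set
      Position = Maximal ⊎ (∃[ c ] ∃[ d ] Cyclic c d)

      data Alternative : Set where
        equal    : b ≡ o → Alternative
        flat     : Maximal → o · b ≡ o → o ∥ b ⊎ b ⊑ o → Alternative
        upward   : ∀ {c} → Cyclic b c → Alternative
        downward : ∀ {c} → Cyclic c b → Alternative

      alternative : ∃[ l ] b ≡ entry l → Position → Alternative
      alternative (l , e) (inj₁ p) with compare o b
      ... | below (e′ , _) = equal (trans (sym e′) (trans (cong (o ·_) e) (p l)))
      ... | above b⊑o = flat p (trans (cong (o ·_) e) (p l)) (inj₂ b⊑o)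
      ... | parallel par = flat p (trans (cong (o ·_) e) (p l)) (inj₁ par)
      alternative (l , e) (inj₂ (c , d , C)) =
        go (triple i j k l) (trans e (labelled l))
        where
        open Cyclic C
        go : ∀ m → b ≡ triple o c d m → Alternative
        go 0F e    = equal e
        go 1F e    = upward (subst (λ t → Cyclic t d) (sym e) C)
        go 2F e    = downward (subst (Cyclic c) (sym e) C)

      eval-at : Fin 3 → Term → X
      eval-at p = eval _·_ entry (at p b o)

      eval-cyclic : ∀ {c d} (C : Cyclic c d) → let open Cyclic C in
        ∀ p {m} → b ≡ triple o c d m →
        ∀ t → eval-at p t ≡ triple o c d (eval _⊙_ (triple i j k) (at p m 0F) t)
      eval-cyclic {c} {d} C p e = eval-cycle cyc labelled
        (λ l → trans (cong (if does (l Fin.≟ p) then_else o) e)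
                     (sym (if-float (triple o c d) (does (l Fin.≟ p)))))
        where
        open Cyclic C

      meet-up-upward : ∀ {c} → Cyclic b c → ∀ p → eval-at p meet-up ≡ o
      meet-up-upward {c} C p = trans (eval-cyclic C p refl meet-up)
        (cong (triple o b c) (meet-up-⊙ distinct p))
        where
        open Cyclic C

      -- The leftmost leaf of `meet-up` is `point 0F`, which has the value o outside column 0.
      meet-up-flat : Maximal → o · b ≡ o → ∀ p → p ≢ 0F → eval-at p meet-up ≡ o
      meet-up-flat q e p p≢0 = eval-leftmost q (λ l → absorbs (does (l Fin.≟ p)))
        (outside (0F Fin.≟ p)) meet-up meet-up-leftmost
        where
        absorbs : ∀ β → o · (if β then b else o) ≡ o
        absorbs true  = e
        absorbs false = ·-idem o
        outside : (d : Dec (0F ≡ p)) → (if does d then b else o) ≡ o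
        outside (yes 0≡p) = ⊥-elim (p≢0 (sym 0≡p))
        outside (no _) = refl

      meet-down-upward : ∀ {c} → Cyclic b c → ∀ p → p ≢ 0F → eval-at p meet-down ≡ o
      meet-down-upward C 0F p≢0 = ⊥-elim (p≢0 refl)
      meet-down-upward {c} C 1F _ = trans (eval-cyclic C 1F refl meet-down)
        (cong (triple o b c) (meet-down-⊙ (Cyclic.distinct C) 1F))
      meet-down-upward {c} C 2F _ = trans (eval-cyclic C 2F refl meet-down)
        (cong (triple o b c) (meet-down-⊙ (Cyclic.distinct C) 2F))

      meet-down-downward : ∀ {c} → Cyclic c b → eval-at 0F meet-down ≡ o
      meet-down-downward {c} C = trans (eval-cyclic C 0F refl meet-down)
        (cong (triple o c b) (meet-down-⊙ distinct 0F))
        where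
        open Cyclic C

      data Up : Set where
        flat   : Maximal → o · b ≡ o → Up
        upward : ∀ {c} → Cyclic b c → Up

      meet-up-up : Up → ∀ p → p ≢ 0F → eval-at p meet-up ≡ o
      meet-up-up (flat q e) = meet-up-flat q e
      meet-up-up (upward C) p _ = meet-up-upward C p

    open Column

    -- Combining the three replacements.

    record Neighbours (C D E : Column) : Set where
      field
        rows : ∀ i → R (entry C i) (entry D i) (entry E i)
        nb₁  : R (b C) (o D) (o E)
        nb₂  : R (o C) (b D) (o E)
        nb₃  : R (o C) (o D) (b E)

    module _ {C D E : Column} (N : Neighbours C D E) where
      open Neighbours N

      nbs-swap₁₂ : Neighbours D C E
      nbs-swap₁₂ = record { rows = λ i → swap₁₂ (rows i)
        ; nb₁ = swap₁₂ nb₂ ; nb₂ = swap₁₂ nb₁ ; nb₃ = swap₁₂ nb₃ }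

      nbs-swap₂₃ : Neighbours C E D
      nbs-swap₂₃ = record { rows = λ i → swap₂₃ (rows i)
        ; nb₁ = swap₂₃ nb₁ ; nb₂ = swap₂₃ nb₃ ; nb₃ = swap₂₃ nb₂ }

      nbs-eval : ∀ t → R (eval-at C 0F t) (eval-at D 1F t) (eval-at E 2F t)
      nbs-eval = eval-pres rows λ { 0F → nb₁ ; 1F → nb₂ ; 2F → nb₃ }

      -- In the product of the first two replaced triples, b gives way to o in C, and o survives in
      -- D.
      descend : b C ⊑ o C → o D · b D ≡ o D → R (o C) (o D) (o E)
      descend (p , _) q = R-resp p q (·-idem _) (·-pres nb₁ nb₂)

      -- The upward column must come first, as a flat one evaluates `meet-up` to o only outside
      -- column 0.
      ascend : ∀ {c} → Cyclic C (b C) c → Up D → Up E → R (o C) (o D) (o E)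
      ascend c d e = R-resp (meet-up-upward C c 0F) (meet-up-up D d 1F λ ())
        (meet-up-up E e 2F λ ()) (nbs-eval meet-up)

      -- Here `descend` does not apply, because the replacements in D and E beat o.
      descend-cyclic : ∀ {c d e} → Cyclic C c (b C) → Cyclic D (b D) d → Cyclic E (b E) e →
        R (o C) (o D) (o E)
      descend-cyclic c d e = R-resp (meet-down-downward C c) (meet-down-upward D d 1F λ ())
        (meet-down-upward E e 2F λ ()) (nbs-eval meet-down)

    nbs-rot : ∀ {C D E} → Neighbours C D E → Neighbours D E C
    nbs-rot N = nbs-swap₂₃ (nbs-swap₁₂ N)

    falls : ∀ {C c} → Cyclic C c (b C) → b C ⊑ o C
    falls c = Cycle.z⊑x (Cyclic.cyc c)

    absorbs : ∀ {C c} → Cyclic C c (b C) → o C · b C ≡ o C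
    absorbs c = proj₂ (Cycle.z⊑x (Cyclic.cyc c))

    -- Up to permutation and apart from `equal`: three parallel columns; a replacement below o
    -- beside a column where o survives (`descend`); flat and upward columns, at least one upward
    -- (`ascend`); one downward and two upward (`descend-cyclic`).
    resolve : ∀ {C D E} → Neighbours C D E → Alternative C → Alternative D → Alternative E →
      R (o C) (o D) (o E)
    resolve N (equal e) _ _ = R-resp e refl refl (Neighbours.nb₁ N)
    resolve N _ (equal e) _ = R-resp refl e refl (Neighbours.nb₂ N)
    resolve N _ _ (equal e) = R-resp refl refl e (Neighbours.nb₃ N)
    resolve N (flat _ _ (inj₁ c)) (flat _ _ (inj₁ d)) (flat _ _ (inj₁ e)) =
      ∥-neighbours⇒R c d e (Neighbours.nb₁ N) (Neighbours.nb₂ N) (Neighbours.nb₃ N)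
    resolve N (flat _ _ (inj₂ c)) (flat _ d _) _ = descend N c d
    resolve N (flat _ c _) (flat _ _ (inj₂ d)) _ = swap₁₂ (descend (nbs-swap₁₂ N) d c)
    resolve N (flat _ c _) (flat _ _ _) (flat _ _ (inj₂ e)) =
      rot (descend (nbs-rot (nbs-rot N)) e c)
    resolve N (upward c) (flat p d _) (flat q e _) = ascend N c (flat p d) (flat q e)
    resolve N (upward c) (flat p d _) (upward e) = ascend N c (flat p d) (upward e)
    resolve N (upward c) (upward d) (flat q e _) = ascend N c (upward d) (flat q e)
    resolve N (upward c) (upward d) (upward e) = ascend N c (upward d) (upward e)
    resolve N (flat p c _) (upward d) (flat q e _) =
      swap₁₂ (ascend (nbs-swap₁₂ N) d (flat p c) (flat q e))
    resolve N (flat p c _) (upward d) (upward e) =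
      swap₁₂ (ascend (nbs-swap₁₂ N) d (flat p c) (upward e))
    resolve N (flat p c _) (flat q d _) (upward e) =
      rot (ascend (nbs-rot (nbs-rot N)) e (flat p c) (flat q d))
    resolve N (downward c) (flat _ d _) _ = descend N (falls c) d
    resolve N (downward c) (downward d) _ = descend N (falls c) (absorbs d)
    resolve N (downward c) _ (flat _ e _) = swap₂₃ (descend (nbs-swap₂₃ N) (falls c) e)
    resolve N (downward c) _ (downward e) = swap₂₃ (descend (nbs-swap₂₃ N) (falls c) (absorbs e))
    resolve N (downward c) (upward d) (upward e) = descend-cyclic N c d e
    resolve N (flat _ c _) (downward d) _ = swap₁₂ (descend (nbs-swap₁₂ N) (falls d) c)
    resolve N (flat _ c _) _ (downward e) = rot (descend (nbs-rot (nbs-rot N)) (falls e) c)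
    resolve N (upward c) (downward d) (flat _ e _) =
      rot⁻¹ (descend (nbs-rot N) (falls d) e)
    resolve N (upward c) (downward d) (downward e) =
      rot⁻¹ (descend (nbs-rot N) (falls d) (absorbs e))
    resolve N (upward c) (downward d) (upward e) =
      swap₁₂ (descend-cyclic (nbs-swap₁₂ N) d c e)
    resolve N (upward c) (flat _ d _) (downward e) =
      rot (swap₂₃ (descend (nbs-swap₂₃ (nbs-rot (nbs-rot N))) (falls e) d))
    resolve N (upward c) (upward d) (downward e) =
      rot (descend-cyclic (nbs-rot (nbs-rot N)) e c d)

    -- The position of the value of u in its column.

    module _
      (w : X → X → X → X)
      (w-choice : ∀ x y z → w x y z ≡ x ⊎ w x y z ≡ y ⊎ w x y z ≡ z)
      (w-⊑ : ∀ {a b} → a ≢ b → a ⊑ b → ∀ {x y z} →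
             x ≡ a ⊎ x ≡ b → y ≡ a ⊎ y ≡ b → z ≡ a ⊎ z ≡ b → w x y z ≡ x · y · z)
      where

      u : X → X → X → X
      u x y z = w (x · y · z) (y · z · x) (z · x · y)

      ·-absorbsˡ : ∀ x y → x · y · x ≡ x · y
      ·-absorbsˡ x y with compare x y
      ... | below (p , q) = trans (cong (_· x) p) (trans q (sym p))
      ... | above (p , q) = trans (cong (_· x) q) (trans (·-idem x) (sym q))
      ... | parallel (_ , p , _) = trans (cong (_· x) p) (trans (·-idem x) (sym p))

      ·-absorbsʳ : ∀ x y → x · y · y ≡ x · y
      ·-absorbsʳ x y with ·-choice x y
      ... | inj₁ e = cong (_· y) e
      ... | inj₂ e = trans (cong (_· y) e) (trans (·-idem y) (sym e))

      ⊑-refl : ∀ x → x ⊑ x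
      ⊑-refl x = ·-idem x , ·-idem x

      chosen⇒⊑ : ∀ {x y} → x · y ≡ y → x ⊑ y
      chosen⇒⊑ {x} {y} e with compare x y
      ... | below p = p
      ... | above (_ , p) = subst (x ⊑_) (trans (sym p) e) (⊑-refl x)
      ... | parallel (_ , p , _) = subst (x ⊑_) (trans (sym p) e) (⊑-refl x)

      ⊑-or-fixed : ∀ x y → (x ⊑ y × x ≢ y) ⊎ x · y ≡ x
      ⊑-or-fixed x y with ·-choice x y | x ≟ y
      ... | inj₁ e | _ = inj₂ e
      ... | inj₂ _ | yes refl = inj₂ (·-idem x)
      ... | inj₂ e | no x≢y = inj₁ (chosen⇒⊑ e , x≢y)

      maximal-in : ∀ {x y z o b} → o · x ≡ o → o · y ≡ o → o · z ≡ o →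
        Position (column x y z o b)
      maximal-in p q r = inj₁ λ { 0F → p ; 1F → q ; 2F → r }

      position-rot : ∀ {x y z o b} → Position (column x y z o b) → Position (column z x y o b)
      position-rot (inj₁ p) = maximal-in (p 2F) (p 0F) (p 1F)
      position-rot (inj₂ (c , d , cyclic cyc i j k (d₁ , d₂ , d₃) l)) =
        inj₂ (c , d , cyclic cyc k i j (d₃ , d₁ , d₂) λ { 0F → l 2F ; 1F → l 0F ; 2F → l 1F })

      -- The exceptional case has x ⊑ z ⊑ y and x ∥ y.
      position-· : ∀ x y z {b} → Position (column x y z (x · y · z) b) ⊎
        (z ⊑ y × z ≢ y × x · y · z ≡ z × y · z · x ≡ y × z · x · y ≡ y)
      position-· x y z {b} with ⊑-or-fixed (x · y) z
      ... | inj₂ e = inj₁ (subst (λ o → Position (column x y z o b)) (sym e)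
              (maximal-in (·-absorbsˡ x y) (·-absorbsʳ x y) e))
      ... | inj₁ (q⊑z , _) with ·-choice x y
      ...   | inj₁ q≡x = go (⊑-or-fixed z y)
        where
        at-z : Position (column x y z z b) → Position (column x y z (x · y · z) b)
        at-z = subst (λ o → Position (column x y z o b)) (sym (proj₁ q⊑z))
        x⊑z : x ⊑ z
        x⊑z = subst (_⊑ z) q≡x q⊑z
        go : (z ⊑ y × z ≢ y) ⊎ z · y ≡ z → Position (column x y z (x · y · z) b) ⊎
          (z ⊑ y × z ≢ y × x · y · z ≡ z × y · z · x ≡ y × z · x · y ≡ y)
        go (inj₂ e) = inj₁ (at-z (maximal-in (proj₂ x⊑z) e (·-idem z)))
        go (inj₁ (z⊑y , z≢y)) with ·-choice y x
        ... | inj₂ e = inj₁ (at-z (inj₂ (y , x , cyclic (cycle z⊑y (chosen⇒⊑ e) x⊑z)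
                2F 1F 0F ((λ ()) , (λ ()) , λ ()) λ { 0F → refl ; 1F → refl ; 2F → refl })))
        ... | inj₁ e = inj₂ (z⊑y , z≢y , proj₁ q⊑z ,
                trans (cong (_· x) (proj₂ z⊑y)) e ,
                trans (cong (_· y) (proj₂ x⊑z)) (proj₁ z⊑y))
      ...   | inj₂ q≡y with ⊑-or-fixed z x
      ...     | inj₂ e = inj₁ (subst (λ o → Position (column x y z o b)) (sym (proj₁ q⊑z))
                (maximal-in e (proj₂ (subst (_⊑ z) q≡y q⊑z)) (·-idem z)))
      ...     | inj₁ (z⊑x , _) = inj₁ (subst (λ o → Position (column x y z o b)) (sym (proj₁ q⊑z))
                (inj₂ (x , y , cyclic (cycle z⊑x (chosen⇒⊑ q≡y) (subst (_⊑ z) q≡y q⊑z))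
                  1F 2F 0F ((λ ()) , (λ ()) , λ ()) λ { 0F → refl ; 1F → refl ; 2F → refl })))

      -- If `w` chose an exceptional product z, the other two products would equal some y strictly
      -- above z. On {z,y} the operation `w` is the semilattice operation and returns y.
      position-u : ∀ x y z {b} → Position (column x y z (u x y z) b)
      position-u x y z {b} with w-choice (x · y · z) (y · z · x) (z · x · y)
      ... | inj₁ e with position-· x y z {b}
      ...   | inj₁ p = subst (λ o → Position (column x y z o b)) (sym e) p
      ...   | inj₂ (z⊑y , z≢y , p , q , r) = ⊥-elim (z≢y
              (trans (sym p) (trans (sym e) (trans (w-⊑ z≢y z⊑y (inj₁ p) (inj₂ q) (inj₂ r))
                (trans (cong₂ _·_ (trans (cong₂ _·_ p q) (proj₁ z⊑y)) r) (·-idem y))))))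
      position-u x y z {b} | inj₂ (inj₁ e) with position-· y z x {b}
      ...   | inj₁ p = subst (λ o → Position (column x y z o b)) (sym e) (position-rot p)
      ...   | inj₂ (x⊑z , x≢z , p , q , r) = ⊥-elim (x≢z
              (trans (sym p) (trans (sym e) (trans (w-⊑ x≢z x⊑z (inj₂ r) (inj₁ p) (inj₂ q))
                (trans (cong₂ _·_ (trans (cong₂ _·_ r p) (proj₂ x⊑z)) q) (·-idem z))))))
      position-u x y z {b} | inj₂ (inj₂ e) with position-· z x y {b}
      ...   | inj₁ p = subst (λ o → Position (column x y z o b)) (sym e)
              (position-rot (position-rot p))
      ...   | inj₂ (y⊑x , y≢x , p , q , r) = ⊥-elim (y≢x
              (trans (sym p) (trans (sym e) (trans (w-⊑ y≢x y⊑x (inj₂ q) (inj₂ r) (inj₁ p))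
                (trans (cong₂ _·_ (trans (cong₂ _·_ q r) (·-idem x)) p) (proj₂ y⊑x))))))

      Neighbour₃ : Set
      Neighbour₃ = (ρ₁ ρ₂ ρ₃ : Fin 3 → X) → (∀ i → R (ρ₁ i) (ρ₂ i) (ρ₃ i)) →
        ∃[ i ] R (ρ₁ i) (u (ρ₂ 0F) (ρ₂ 1F) (ρ₂ 2F)) (u (ρ₃ 0F) (ρ₃ 1F) (ρ₃ 2F))

      column-of : (Fin 3 → X) → Fin 3 → Column
      column-of ρ l = column (ρ 0F) (ρ 1F) (ρ 2F) (u (ρ 0F) (ρ 1F) (ρ 2F)) (ρ l)

      entry-of : ∀ ρ l i → entry (column-of ρ l) i ≡ ρ i
      entry-of ρ l 0F = refl
      entry-of ρ l 1F = refl
      entry-of ρ l 2F = refl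

      alternative-of : ∀ ρ l → Alternative (column-of ρ l)
      alternative-of ρ l = alternative (column-of ρ l) (l , sym (entry-of ρ l l))
        (position-u (ρ 0F) (ρ 1F) (ρ 2F))

      u-pres : Neighbour₃ → (ρ₁ ρ₂ ρ₃ : Fin 3 → X) → (∀ i → R (ρ₁ i) (ρ₂ i) (ρ₃ i)) →
        R (u (ρ₁ 0F) (ρ₁ 1F) (ρ₁ 2F)) (u (ρ₂ 0F) (ρ₂ 1F) (ρ₂ 2F)) (u (ρ₃ 0F) (ρ₃ 1F) (ρ₃ 2F))
      u-pres neighbour ρ₁ ρ₂ ρ₃ rows =
        -- Each coordinate in turn is moved to the front to obtain its replacement.
        let l₁ , n₁ = neighbour ρ₁ ρ₂ ρ₃ rows
            l₂ , n₂ = neighbour ρ₂ ρ₁ ρ₃ (λ i → swap₁₂ (rows i))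
            l₃ , n₃ = neighbour ρ₃ ρ₁ ρ₂ (λ i → rot⁻¹ (rows i))
            N : Neighbours (column-of ρ₁ l₁) (column-of ρ₂ l₂) (column-of ρ₃ l₃)
            N = record
              { rows = λ i → R-resp (sym (entry-of ρ₁ l₁ i)) (sym (entry-of ρ₂ l₂ i))
                                    (sym (entry-of ρ₃ l₃ i)) (rows i)
              ; nb₁ = n₁ ; nb₂ = swap₁₂ n₂ ; nb₃ = rot n₃ }
        in resolve N (alternative-of ρ₁ l₁) (alternative-of ρ₂ l₂) (alternative-of ρ₃ l₃)

-- Atoms of a symmetric relation algebra.

does⇒ : {P : Set} (d : Dec P) → does d ≡ true → P
does⇒ (yes p) _ = p

⇒does : {P : Set} (d : Dec P) → P → does d ≡ true
⇒does (yes _) _ = refl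
⇒does (no ¬p) p = ⊥-elim (¬p p)

module AtomStructure {n : ℕ} (A : RelAlg n) where
  open Alg A

  atom-≡ : ∀ {x y : Atom} → proj₁ x ≡ proj₁ y → x ≡ y
  atom-≡ {a , p} {_ , q} refl = cong (a ,_) (T-irrelevant p q)

  _≟ₐ_ : DecidableEquality Atom
  (a , p) ≟ₐ (b , q) = map′ atom-≡ (cong proj₁) (a Fin.≟ b)

  R? : ∀ x y z → Dec (R x y z)
  R? x y z = proj₁ z ≤? (proj₁ x ⨾ proj₁ y)

  -- The element x ⨾ y equals its own converse, which is y ⨾ x.
  R-swap₁₂ : Symmetric → ∀ {x y z} → R x y z → R y x z
  R-swap₁₂ symmetric {x , _} {y , _} {z , _} = subst (z ≤_)
    (trans (sym (symmetric (x ⨾ y))) (trans (˘-⨾ x y) (cong₂ _⨾_ (symmetric y) (symmetric x))))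

  module _ (𝔅 : Representation) where
    open Representation 𝔅
    open Equivalence using (to; from)

    -- By Huntington's equation `a` contains the complement of `‾ a ∪ ‾ a`, and complements are
    -- represented by negations.
    ρ-stable : ∀ a {d e} → ¬ ¬ ρ a d e → ρ a d e
    ρ-stable a {d} {e} ¬¬a = subst (λ c → ρ c d e) (sym (huntington a a))
      (from (ρ-∪ _ _ d e) (inj₁ (from (ρ-‾ _ d e) λ p → ¬¬a (empty (to (ρ-∪ _ _ d e) p)))))
      where
      empty : ρ (‾ a) d e ⊎ ρ (‾ a) d e → ¬ ρ a d e
      empty (inj₁ p) = to (ρ-‾ a d e) p
      empty (inj₂ p) = to (ρ-‾ a d e) p

    ρ-≤ : ∀ {a b} → (∀ d e → ρ a d e → ρ b d e) → a ≤ b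
    ρ-≤ {a} {b} a⇒b = ρ-injective _ _ λ d e → mk⇔
      (λ p → join (a⇒b d e) (to (ρ-∪ a b d e) p)) (λ p → from (ρ-∪ a b d e) (inj₂ p))
      where
      join : ∀ {P Q : Set} → (P → Q) → P ⊎ Q → Q
      join f (inj₁ p) = f p
      join f (inj₂ q) = q

    ρ-meet : ∀ a b {d e} → ρ (‾ (‾ a ∪ ‾ b)) d e → ρ a d e × ρ b d e
    ρ-meet a b {d} {e} p =
      ρ-stable a (λ ¬a → to (ρ-‾ _ d e) p (from (ρ-∪ _ _ d e) (inj₁ (from (ρ-‾ a d e) ¬a)))) ,
      ρ-stable b (λ ¬b → to (ρ-‾ _ d e) p (from (ρ-∪ _ _ d e) (inj₂ (from (ρ-‾ b d e) ¬b))))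

    meet-ρ : ∀ a b {d e} → ρ a d e → ρ b d e → ρ (‾ (‾ a ∪ ‾ b)) d e
    meet-ρ a b {d} {e} p q = from (ρ-‾ _ d e) λ r → disjoint (to (ρ-∪ _ _ d e) r)
      where
      disjoint : ¬ (ρ (‾ a) d e ⊎ ρ (‾ b) d e)
      disjoint (inj₁ r) = to (ρ-‾ a d e) r p
      disjoint (inj₂ r) = to (ρ-‾ b d e) r q

    -- The meet of the atom with b is 𝟘 or the atom, and the pair (d,e) rules out 𝟘.
    atom-≤ : ∀ (y : Atom) b {d e} → ρ (proj₁ y) d e → ρ b d e → proj₁ y ≤ b
    atom-≤ (y , y-atom) b {d} {e} p q
      with proj₂ (toWitness y-atom) (‾ (‾ y ∪ ‾ b)) (ρ-≤ λ d e r → proj₁ (ρ-meet y b r))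
    ... | inj₁ ≡𝟘 = ⊥-elim (ρ-𝟘 d e (subst (λ c → ρ c d e) ≡𝟘 (meet-ρ y b p q)))
    ... | inj₂ ≡y = ρ-≤ λ d e r → proj₂ (ρ-meet y b (subst (λ c → ρ c d e) (sym ≡y) r))

    atom-nonempty : ∀ (z : Atom) → ¬ (∀ d e → ¬ ρ (proj₁ z) d e)
    atom-nonempty (z , z-atom) empty = proj₁ (toWitness z-atom)
      (ρ-injective z 𝟘 λ d e → mk⇔ (λ p → ⊥-elim (empty d e p)) (λ p → ⊥-elim (ρ-𝟘 d e p)))

    -- A pair (d,e) in z has a midpoint m with (d,m) in x and (m,e) in y; by symmetry (m,e) also
    -- lies in x ⨾ z. The pair exists only up to double negation, which decidability removes.
    R-swap₂₃ : Symmetric → ∀ {x y z} → R x y z → R x z y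
    R-swap₂₃ symmetric {x} {y} {z} z≤xy = decidable-stable (R? x z y) λ ¬r →
      atom-nonempty z λ d e p →
        let m , q , r = to (ρ-⨾ _ _ d e)
              (subst (λ c → ρ c d e) z≤xy (from (ρ-∪ _ _ d e) (inj₁ p)))
        in ¬r (atom-≤ y _ r (from (ρ-⨾ _ _ m e)
             (d , subst (λ c → ρ c m d) (symmetric (proj₁ x)) (from (ρ-˘ _ m d) q) , p)))

  module _ {k : ℕ} (f : Op k) (pol : Pol 𝔄₀ᵇ f) where

    -- The set of entries of x is itself a unary relation of the binarisation.
    chooses : ∀ x → ∃[ i ] f x ≡ x i
    chooses x = does⇒ (entry? (f x)) (pol (unary (λ a → does (entry? a))) (λ i _ → x i)
      λ i → ⇒does (entry? (x i)) (i , refl))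
      where
      entry? : ∀ a → Dec (∃[ i ] a ≡ x i)
      entry? a = any? λ i → a ≟ₐ x i

    conservative : (P : Atom → Set) → ∀ x → (∀ i → P (x i)) → P (f x)
    conservative P x p = let i , e = chooses x in subst P (sym e) (p i)

    -- The union of the relations `Rₐ a` over the entries a of x is preserved.
    neighbour : ∀ (x y z : Vector Atom k) → (∀ i → R (x i) (y i) (z i)) →
      ∃[ i ] R (x i) (f y) (f z)
    neighbour x y z r with pol (union (λ a → does (entry? a))) (λ i → y i ∷ z i ∷ [])
        (λ i → x i , ⇒does (entry? (x i)) (i , refl) , r i)
      where
      entry? : ∀ a → Dec (∃[ i ] a ≡ x i)
      entry? a = any? λ i → a ≟ₐ x i
    ... | a , e , s = let i , a≡ = does⇒ (any? λ i → a ≟ₐ x i) e in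
      i , subst (λ a → R a (f y) (f z)) a≡ s

  -- Polymorphisms of the binarisation and of the atom structure.

  module Polymorphisms (symmetric : Symmetric) (𝔅 : Representation) (R-refl : All1Cycles) where

    -- R unfolds to an equation that does not determine the atoms, so it is wrapped in a record.
    record Allowed (x y z : Atom) : Set where
      constructor allowed
      field is-allowed : R x y z
    open Allowed

    allowed? : ∀ x y z → Dec (Allowed x y z)
    allowed? x y z = map′ allowed is-allowed (R? x y z)

    allowed-swap₁₂ : ∀ {x y z} → Allowed x y z → Allowed y x z
    allowed-swap₁₂ {x} {y} {z} (allowed r) = allowed (R-swap₁₂ symmetric {x} {y} {z} r)

    allowed-swap₂₃ : ∀ {x y z} → Allowed x y z → Allowed x z y
    allowed-swap₂₃ {x} {y} {z} (allowed r) = allowed (R-swap₂₃ 𝔅 symmetric {x} {y} {z} r)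

    allowed-refl : ∀ x → Allowed x x x
    allowed-refl x = allowed (R-refl x)

    open TernaryRelation Allowed allowed-swap₁₂ allowed-swap₂₃

    toBinary : ∀ v → Pol 𝔄₀ᵇ v → Binary
    toBinary v pol = record
      { op = ap2 v ; cons = cons
      ; pres = neighbour⇒pres (ap2 v)
          (λ x y → cons (λ t → t ≡ x ⊎ t ≡ y) (inj₁ refl) (inj₂ refl)) near }
      where
      cons : (P : Atom → Set) → ∀ {x y} → P x → P y → P (ap2 v x y)
      cons P {x} {y} p q = conservative v pol P (x ∷ y ∷ []) λ { 0F → p ; 1F → q }
      near : Neighbour (ap2 v)
      near {x₁} {x₂} {x₃} {y₁} {y₂} {y₃} (allowed r) (allowed s) =
        case (neighbour v pol (x₁ ∷ y₁ ∷ []) (x₂ ∷ y₂ ∷ []) (x₃ ∷ y₃ ∷ [])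
          (λ { 0F → r ; 1F → s }))
        where
        case : ∃[ i ] R ((x₁ ∷ y₁ ∷ []) i) (ap2 v x₂ y₂) (ap2 v x₃ y₃) →
          Allowed x₁ (ap2 v x₂ y₂) (ap2 v x₃ y₃) ⊎ Allowed y₁ (ap2 v x₂ y₂) (ap2 v x₃ y₃)
        case (0F , t) = inj₁ (allowed t)
        case (1F , t) = inj₂ (allowed t)

    fromBinary : Binary → Op 2
    fromBinary g t = Binary.op g (t 0F) (t 1F)

    -- Idempotence keeps the first coordinate a of `Rₐ a` fixed; conservativity keeps it inside T
    -- for a union.
    fromBinary-pol : ∀ g → Pol 𝔄₀ᵇ (fromBinary g)
    fromBinary-pol g (unary S) M p = Binary.cons g (λ a → S a ≡ true) (p 0F) (p 1F)
    fromBinary-pol g (Rₐ a) M p = is-allowed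
      (subst (λ b → Allowed b (fromBinary g (λ i → M i 0F)) (fromBinary g (λ i → M i 1F)))
        (Binary.idem g a) (Binary.pres g (allowed (p 0F)) (allowed (p 1F))))
    fromBinary-pol g (union T) M p =
      let a , a∈ , r = p 0F
          b , b∈ , s = p 1F
      in Binary.op g a b , Binary.cons g (λ a → T a ≡ true) a∈ b∈ ,
         is-allowed (Binary.pres g (allowed r) (allowed s))

    toSiggers : SiggersBehaviour → Siggers
    toSiggers (s , pres , choice , identity) = record
      { op = ap6 s ; cons = cons ; identity = identity
      ; pres = λ {x₁} {x₂} {x₃} {x₄} {x₅} {x₆} {y₁} {y₂} {y₃} {y₄} {y₅} {y₆}
          {z₁} {z₂} {z₃} {z₄} {z₅} {z₆} (allowed r₁) (allowed r₂) (allowed r₃)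
          (allowed r₄) (allowed r₅) (allowed r₆) → allowed (pres
          (λ i j → triple (x₁ ∷ x₂ ∷ x₃ ∷ x₄ ∷ x₅ ∷ x₆ ∷ []) (y₁ ∷ y₂ ∷ y₃ ∷ y₄ ∷ y₅ ∷ y₆ ∷ [])
                          (z₁ ∷ z₂ ∷ z₃ ∷ z₄ ∷ z₅ ∷ z₆ ∷ []) j i)
          λ { 0F → r₁ ; 1F → r₂ ; 2F → r₃ ; 3F → r₄ ; 4F → r₅ ; 5F → r₆ }) }
      where
      cons : (P : Atom → Set) → ∀ {x₁ x₂ x₃ x₄ x₅ x₆} →
        P x₁ → P x₂ → P x₃ → P x₄ → P x₅ → P x₆ → P (ap6 s x₁ x₂ x₃ x₄ x₅ x₆)
      cons P {x₁} {x₂} {x₃} {x₄} {x₅} {x₆} p₁ p₂ p₃ p₄ p₅ p₆ =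
        let i , e = choice xs in subst P (sym e) (all i)
        where
        xs : Vector Atom 6
        xs = x₁ ∷ x₂ ∷ x₃ ∷ x₄ ∷ x₅ ∷ x₆ ∷ []
        all : ∀ i → P (xs i)
        all 0F = p₁
        all 1F = p₂
        all 2F = p₃
        all 3F = p₄
        all 4F = p₅
        all 5F = p₆

    module _ (v : Op 2) (v-pol : Pol 𝔄₀ᵇ v)
      (v-edge : ∀ a b → a ≢ b →
        (HasSemilatticeEdge a b → IsSemilatticeOn v a b)
        × (¬ HasSemilatticeEdge a b →
            ∀ x y → x ∈⟨ a , b ⟩ → y ∈⟨ a , b ⟩ → ap2 v x y ≡ x)) where

      vᵇ : Binary
      vᵇ = toBinary v v-pol

      edge⇒comm : ∀ {x y} → x ≢ y → HasSemilatticeEdge x y → ap2 v x y ≡ ap2 v y x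
      edge⇒comm x≢y e = proj₁ (proj₂ (proj₂ (proj₁ (v-edge _ _ x≢y) e))) _ _ (inj₁ refl) (inj₂ refl)

      -- The case distinction is on commutativity of `v`, which is decidable; failure of it refutes
      -- a semilattice edge.
      v-dichotomy : ∀ x y → (ap2 v x y ≡ x × ap2 v y x ≡ y) ⊎ ap2 v x y ≡ ap2 v y x
      v-dichotomy x y with x ≟ₐ y | ap2 v x y ≟ₐ ap2 v y x
      ... | yes refl | _ = inj₂ refl
      ... | no _ | yes e = inj₂ e
      ... | no x≢y | no ¬e = inj₁ (first x y (inj₁ refl) (inj₂ refl) , first y x (inj₂ refl) (inj₁ refl))
        where first = proj₂ (v-edge x y x≢y) (λ edge → ¬e (edge⇒comm x≢y edge))

      -- A `g` commuting on the pair would witness a semilattice edge, and `v` would commute there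
      -- too.
      v-rigid : ∀ {x y} → x ≢ y → ap2 v x y ≡ x → ap2 v y x ≡ y →
        (g : Binary) → Binary.op g x y ≢ Binary.op g y x
      v-rigid {x} {y} x≢y p q g e =
        x≢y (trans (sym p) (trans (edge⇒comm x≢y (edge (Binary.choice g x y))) q))
        where
        edge : Binary.op g x y ≡ x ⊎ Binary.op g x y ≡ y → HasSemilatticeEdge x y
        edge (inj₁ ≡x) = inj₂ (fromBinary g , fromBinary-pol g ,
          trans (sym e) ≡x , ≡x , Binary.idem g x , Binary.idem g y)
        edge (inj₂ ≡y) = inj₁ (fromBinary g , fromBinary-pol g ,
          ≡y , trans (sym e) ≡y , Binary.idem g y , Binary.idem g x)

      module _ (s : SiggersBehaviour) (w : Op 3) (w-pol : Pol 𝔄₀ᵇ w)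
        (w-edge : ∀ a b → a ≢ b → HasSemilatticeEdge a b →
          ∀ x y z → x ∈⟨ a , b ⟩ → y ∈⟨ a , b ⟩ → z ∈⟨ a , b ⟩ →
          ap3 w x y z ≡ ap2 v (ap2 v x y) z) where

        open Rigidity allowed? allowed-refl vᵇ v-dichotomy v-rigid _≟ₐ_ (toSiggers s)

        w-choice : ∀ x y z → ap3 w x y z ≡ x ⊎ ap3 w x y z ≡ y ⊎ ap3 w x y z ≡ z
        w-choice x y z = conservative w w-pol (λ t → t ≡ x ⊎ t ≡ y ⊎ t ≡ z) (x ∷ y ∷ z ∷ [])
          λ { 0F → inj₁ refl ; 1F → inj₂ (inj₁ refl) ; 2F → inj₂ (inj₂ refl) }

        w-⊑ : ∀ {a b} → a ≢ b → a ⊑ b → ∀ {x y z} →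
          x ≡ a ⊎ x ≡ b → y ≡ a ⊎ y ≡ b → z ≡ a ⊎ z ≡ b → ap3 w x y z ≡ x · y · z
        w-⊑ {a} {b} a≢b (p , q) = w-edge a b a≢b
          (inj₁ (v , v-pol , p , q , ·-idem b , ·-idem a)) _ _ _

        uOp-pol : Pol 𝔄₀ᵇ (uOp v w) → Pol 𝔄₀ (uOp v w)
        uOp-pol pol (unary S) = pol (unary S)
        -- By symmetry the converse relation is equality of atoms.
        uOp-pol pol conv M p = trans (symmetric _) (cong proj₁ (cong₃ (column-≡ 0F) (column-≡ 1F) (column-≡ 2F)))
          where
          column-≡ : ∀ i → M i 0F ≡ M i 1F
          column-≡ i = atom-≡ (trans (sym (symmetric _)) (p i))
          cong₃ : ∀ {x y z x′ y′ z′} → x ≡ x′ → y ≡ y′ → z ≡ z′ →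
            uOp v w (x ∷ y ∷ z ∷ []) ≡ uOp v w (x′ ∷ y′ ∷ z′ ∷ [])
          cong₃ refl refl refl = refl
        uOp-pol pol tern M p = is-allowed (u-pres (ap3 w) w-choice w-⊑
          (λ ρ₁ ρ₂ ρ₃ rows →
            let i , r = neighbour (uOp v w) pol ρ₁ ρ₂ ρ₃ (λ i → is-allowed (rows i))
            in i , allowed r)
          (λ i → M i 0F) (λ i → M i 1F) (λ i → M i 2F) (λ i → allowed (p i)))

theoremB12 : ∀ {n : ℕ} (A : RelAlg n) → let open Alg A in
    Symmetric →
    HasNormalRepresentation →
    All1Cycles →
    SiggersBehaviour →
    Σ (Op 6) (λ s → Pol 𝔄₀ᵇ s × SiggersIdentity s) →
    NoAffineEdge →
    (v : Op 2) (w : Op 3) → Pol 𝔄₀ᵇ v → Pol 𝔄₀ᵇ w →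
    (∀ a b → a ≢ b →
      (HasSemilatticeEdge a b → IsSemilatticeOn v a b)
      × (¬ HasSemilatticeEdge a b →
          ∀ x y → x ∈⟨ a , b ⟩ → y ∈⟨ a , b ⟩ → ap2 v x y ≡ x)) →
    (∀ a b → a ≢ b →
      (MajorityEdge a b → IsMajorityOn w a b)
      × (HasSemilatticeEdge a b →
          ∀ x y z → x ∈⟨ a , b ⟩ → y ∈⟨ a , b ⟩ → z ∈⟨ a , b ⟩ →
          ap3 w x y z ≡ ap2 v (ap2 v x y) z)) →
    Pol 𝔄₀ᵇ (uOp v w) →
    Pol 𝔄₀ (uOp v w)
theoremB12 A symmetric (𝔅 , _) R-refl siggers _ _ v w v-pol w-pol v-edge w-edge =
  uOp-pol v v-pol v-edge siggers w w-pol (λ a b a≢b → proj₂ (w-edge a b a≢b))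
  where
  open AtomStructure A
  open Polymorphisms symmetric 𝔅 R-refl
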